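{- Let $A$ be an indecomposable Cartan matrix of finite type. Then the set of arithmetic $\mathbf{Y}$-frieze patterns associated to $A$ is finite.
   Context: A Cartan matrix $A=(a_{i,j})$ ($r\times r$) is a symmetrisable integer matrix with $a_{i,i}=2$, $a_{i,j}\le0$ for $i\ne j$, $a_{i,j}=0$ iff $a_{j,i}=0$; finite type means all principal minors are positive; indecomposable means there is no nonempty proper $I\subset[1,r]$ with $a_{i,j}=0$ for all $i\in I,j\notin I$. An arithmetic $\mathbf{Y}$-frieze pattern associated to $A$ is a map $k:[1,r]\times\mathbb{Z}\to\mathbb{Z}_{>0}$ such that for all $(i,m)$, \[ k(i,m)k(i,m+1)=\prod_{j=i+1}^r(1+k(j,m))^{ -a_{j,i}}\prod_{j=1}^{i-1}(1+k(j,m+1))^{ -a_{j,i}}. \] -}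

module Defs where

open import Data.Nat as ℕ using (ℕ; zero; suc)
open import Data.Integer as ℤ using (ℤ; +_; -_; ∣_∣)
open import Data.Fin using (Fin; zero; suc; punchIn; toℕ)
open import Data.Fin.Subset using (Subset; _∈_; _∉_; Nonempty)
open import Data.Product using (Σ; ∃; _×_; _,_)
open import Data.List using (List)
open import Data.List.Membership.Propositional using () renaming (_∈_ to _∈ₗ_)
open import Relation.Nullary using (¬_)
open import Relation.Binary.PropositionalEquality using (_≡_)

-- r × r integer matrices, indices 0 .. r-1 (paper: 1 .. r, same order)
Matrix : ℕ → Set
Matrix r = Fin r → Fin r → ℤ

sumℤ : ∀ {n} → (Fin n → ℤ) → ℤ
sumℤ {zero}  f = + 0
sumℤ {suc n} f = f zero ℤ.+ sumℤ (λ i → f (suc i))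

prodℕ : ∀ {n} → (Fin n → ℕ) → ℕ
prodℕ {zero}  f = 1
prodℕ {suc n} f = f zero ℕ.* prodℕ (λ i → f (suc i))

det : ∀ {n} → Matrix n → ℤ
det {zero}  M = + 1
det {suc n} M =
  sumℤ (λ j → sign j ℤ.* (M zero j ℤ.* det (λ a b → M (suc a) (punchIn j b))))
  where
  sign : Fin (suc n) → ℤ
  sign j = (- (+ 1)) ℤ.^ toℕ j

record IsCartan {r : ℕ} (A : Matrix r) : Set where
  field
    diag      : ∀ i → A i i ≡ + 2
    offdiag   : ∀ i j → ¬ (i ≡ j) → A i j ℤ.≤ + 0
    zeroSym   : ∀ i j → A i j ≡ + 0 → A j i ≡ + 0
    symmetrisable : Σ (Fin r → ℕ) λ d →
                      (∀ i → 0 ℕ.< d i) ×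
                      (∀ i j → (+ d i) ℤ.* A i j ≡ (+ d j) ℤ.* A j i)

StrictlyIncreasing : ∀ {k r} → (Fin k → Fin r) → Set
StrictlyIncreasing {k} f = ∀ (a b : Fin k) → toℕ a ℕ.< toℕ b → toℕ (f a) ℕ.< toℕ (f b)

FiniteType : ∀ {r} → Matrix r → Set
FiniteType {r} A = ∀ (k : ℕ) (f : Fin k → Fin r) → StrictlyIncreasing f →
                   + 0 ℤ.< det (λ a b → A (f a) (f b))

Indecomposable : ∀ {r} → Matrix r → Set
Indecomposable {r} A =
  ¬ (Σ (Subset r) λ I → Nonempty I × (∃ λ j → j ∉ I) ×
       (∀ i j → i ∈ I → j ∉ I → A i j ≡ + 0))

-- exponent factor (1 + x)^(-a_{j,i}) (a_{j,i} ≤ 0 for j ≠ i, so -a_{j,i} = |a_{j,i}|)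
factor : ℤ → ℕ → ℕ
factor a x = (1 ℕ.+ x) ℕ.^ ∣ a ∣

friezeRHS : ∀ {r} → Matrix r → (Fin r → ℤ → ℕ) → Fin r → ℤ → ℕ
friezeRHS {r} A k i m = prodℕ term
  where
  term : Fin r → ℕ
  term j with toℕ i ℕ.<? toℕ j | toℕ j ℕ.<? toℕ i
  ... | Relation.Nullary.yes _ | _ = factor (A j i) (k j m)
  ... | Relation.Nullary.no _ | Relation.Nullary.yes _ = factor (A j i) (k j (m ℤ.+ + 1))
  ... | Relation.Nullary.no _ | Relation.Nullary.no _ = 1

IsArithYFrieze : ∀ {r} → Matrix r → (Fin r → ℤ → ℕ) → Set
IsArithYFrieze A k =
  (∀ i m → 0 ℕ.< k i m) ×
  (∀ i m → k i m ℕ.* k i (m ℤ.+ + 1) ≡ friezeRHS A k i m)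

FiniteSet : ∀ {r} → ((Fin r → ℤ → ℕ) → Set) → Set
FiniteSet {r} S = Σ (List (Fin r → ℤ → ℕ)) λ L →
  ∀ k → S k → ∃ λ k' → k' ∈ₗ L × (∀ i m → k i m ≡ k' i m)

{-# OPTIONS --safe #-}
module Submission where

-- Gaussian elimination on the positive principal minors gives a vector v > 0 with A v > 0. A vertex
-- minimising v has at most one neighbour, so the Dynkin diagram is a forest, and there is a potential that
-- places the entries k i m on a line so that the recurrence for k i between x and x + 2 involves the other
-- rows at x + 1 only. Taking logarithms, log (1 + k) ≤ log 2 + log k and weights v, one gets a sequence
-- Y ≥ 0 with Y x + Y (x + 2) ≤ D + (2 - 1/K) Y (x + 1), which is bounded, since where it
-- is large it would be so concave as to become negative. So the entries of all friezes have a common bound,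
-- and a frieze is determined by its entries at time 0.

open import Defs
open import Data.Nat.Base as ℕ using (ℕ; zero; suc)
import Data.Nat.Properties as ℕ
import Data.Nat.DivMod as ℕ
import Data.Nat.Tactic.RingSolver as ℕ-Solver
open import Data.Integer.Base as ℤ using (ℤ; +_; -_; 0ℤ; 1ℤ; -1ℤ; ∣_∣)
import Data.Integer.Properties as ℤ
import Data.Integer.Tactic.RingSolver as ℤ-Solver
open import Data.Fin.Base as Fin using (Fin; zero; suc; toℕ; punchIn; punchOut; inject₁)
open import Data.Fin.Properties as Fin
  using (_≟_; punchInᵢ≢i; punchIn-punchOut; punchIn-injective; toℕ-inject₁)
open import Data.List.Base using (List; []; _∷_; map; upTo; cartesianProductWith)
open import Data.List.Membership.Propositional using (_∈_)
open import Data.List.Membership.Propositional.Properties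
  using (∈-map⁺; ∈-upTo⁺; ∈-cartesianProductWith⁺)
open import Data.List.Relation.Unary.Any using (here)
open import Data.Product using (∃; _×_; _,_; proj₁; proj₂)
open import Data.Sum as Sum using (_⊎_; inj₁; inj₂)
open import Data.Vec.Functional as Vector using (updateAt; insertAt)
open import Data.Vec.Functional.Properties
  using (updateAt-updates; updateAt-minimal; insertAt-lookup; insertAt-punchIn)
open import Function.Base using (_∘_; const)
open import Relation.Nullary using (yes; no; contradiction; ¬?; decidable-stable)
open import Relation.Binary.Definitions using (tri<; tri≈; tri>)
open import Relation.Binary.PropositionalEquality
import Algebra.Properties.Semiring.Sum as SemiringSum

-- The relation bounds a product of two consecutive entries by neighbouring entries that may be just
-- as large, so no single step gives a bound. Two facts together do: `A · v` positive says that the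
-- neighbours of a row weigh strictly less than twice the row, and entries are at least 1, so their
-- logarithms never become negative. The resulting bound depends on `v` alone, hence serves all
-- friezes at once. The other obstacle is that a neighbour enters at time m or m + 1 according to
-- the order of the rows. The potential absorbs this choice as a shift of 1 along each edge. Around
-- a cycle such shifts need not add up to 0, which is why a forest is wanted. Logarithms are rounded
-- and elimination avoids division, so that all estimates stay in the integers.

module ℤΣ = SemiringSum ℤ.+-*-semiring
module ℕΣ = SemiringSum ℕ.+-*-semiring

-- Sums and products

sumℤ≡sum : ∀ {n} (f : Fin n → ℤ) → sumℤ f ≡ ℤΣ.sum f
sumℤ≡sum {zero}  f = refl
sumℤ≡sum {suc n} f = cong (ℤ._+_ (f zero)) (sumℤ≡sum (f ∘ suc))

sum-zero : ∀ {n} {f : Fin n → ℤ} → (∀ i → f i ≡ 0ℤ) → ℤΣ.sum f ≡ 0ℤ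
sum-zero {n} f≗0 = trans (ℤΣ.sum-cong-≗ f≗0) (ℤΣ.sum-replicate-zero n)

sum-linear : ∀ {n} (a b : ℤ) {f g h : Fin n → ℤ} → (∀ i → f i ≡ a ℤ.* g i ℤ.+ b ℤ.* h i) →
             ℤΣ.sum f ≡ a ℤ.* ℤΣ.sum g ℤ.+ b ℤ.* ℤΣ.sum h
sum-linear a b {f} {g} {h} f≗ag+bh = begin
  ℤΣ.sum f                                                  ≡⟨ ℤΣ.sum-cong-≗ f≗ag+bh ⟩
  ℤΣ.sum (λ i → a ℤ.* g i ℤ.+ b ℤ.* h i)                    ≡⟨ ℤΣ.∑-distrib-+ (λ i → a ℤ.* g i) (λ i → b ℤ.* h i) ⟩
  ℤΣ.sum (λ i → a ℤ.* g i) ℤ.+ ℤΣ.sum (λ i → b ℤ.* h i)     ≡⟨ cong₂ ℤ._+_ (ℤΣ.*-distribˡ-sum a g) (ℤΣ.*-distribˡ-sum b h) ⟨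
  a ℤ.* ℤΣ.sum g ℤ.+ b ℤ.* ℤΣ.sum h                         ∎
  where open ≡-Reasoning

sum-cancelling : ∀ {n} (f : Fin (suc n) → ℤ) (p : Fin n) →
                 (∀ l → l ≢ inject₁ p → l ≢ suc p → f l ≡ 0ℤ) →
                 f (inject₁ p) ℤ.+ f (suc p) ≡ 0ℤ → ℤΣ.sum f ≡ 0ℤ
sum-cancelling f zero off pair = begin
  f zero ℤ.+ (f (suc zero) ℤ.+ ℤΣ.sum (λ i → f (suc (suc i))))
    ≡⟨ cong (λ s → f zero ℤ.+ (f (suc zero) ℤ.+ s)) (sum-zero {f = λ i → f (suc (suc i))} λ i → off (suc (suc i)) (λ ()) (λ ())) ⟩
  f zero ℤ.+ (f (suc zero) ℤ.+ 0ℤ)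
    ≡⟨ cong (ℤ._+_ (f zero)) (ℤ.+-identityʳ (f (suc zero))) ⟩
  f zero ℤ.+ f (suc zero)
    ≡⟨ pair ⟩
  0ℤ ∎
  where open ≡-Reasoning
sum-cancelling f (suc p) off pair =
  cong₂ ℤ._+_ (off zero (λ ()) (λ ()))
    (sum-cancelling (f ∘ suc) p
      (λ l l≢p l≢p′ → off (suc l) (l≢p ∘ Fin.suc-injective) (l≢p′ ∘ Fin.suc-injective)) pair)

term≤sum : ∀ {n} (f : Fin n → ℕ) i → f i ℕ.≤ ℕΣ.sum f
term≤sum f zero    = ℕ.m≤m+n (f zero) _
term≤sum f (suc i) = ℕ.≤-trans (term≤sum (f ∘ suc) i) (ℕ.m≤n+m _ (f zero))

sum-mono : ∀ {n} {f g : Fin n → ℕ} → (∀ i → f i ℕ.≤ g i) → ℕΣ.sum f ℕ.≤ ℕΣ.sum g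
sum-mono {zero}  f≤g = ℕ.z≤n
sum-mono {suc n} f≤g = ℕ.+-mono-≤ (f≤g zero) (sum-mono (f≤g ∘ suc))

pos-sum : ∀ {n} (f : Fin n → ℕ) → + ℕΣ.sum f ≡ ℤΣ.sum (λ i → + f i)
pos-sum {zero}  f = refl
pos-sum {suc n} f = cong (ℤ._+_ (+ f zero)) (pos-sum (f ∘ suc))

sum-single : ∀ {n} (f : Fin n → ℤ) i → (∀ l → l ≢ i → f l ≡ 0ℤ) → ℤΣ.sum f ≡ f i
sum-single f zero    off =
  trans (cong (ℤ._+_ (f zero)) (sum-zero {f = f ∘ suc} λ l → off (suc l) λ ())) (ℤ.+-identityʳ (f zero))
sum-single f (suc i) off =
  trans (cong₂ ℤ._+_ (off zero λ ()) (sum-single (f ∘ suc) i λ l l≢i → off (suc l) (l≢i ∘ Fin.suc-injective)))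
        (ℤ.+-identityˡ (f (suc i)))

sum-nonpos : ∀ {n} {f : Fin n → ℤ} → (∀ i → f i ℤ.≤ 0ℤ) → ℤΣ.sum f ℤ.≤ 0ℤ
sum-nonpos {zero}  f≤0 = ℤ.≤-refl
sum-nonpos {suc n} f≤0 = ℤ.+-mono-≤ (f≤0 zero) (sum-nonpos (f≤0 ∘ suc))

pair≤sum : ∀ {n} (f : Fin n → ℕ) {j k} → j ≢ k → f j ℕ.+ f k ℕ.≤ ℕΣ.sum f
pair≤sum f {zero}  {zero}  j≢k = contradiction refl j≢k
pair≤sum f {zero}  {suc k} j≢k = ℕ.+-monoʳ-≤ (f zero) (term≤sum (f ∘ suc) k)
pair≤sum f {suc j} {zero}  j≢k = subst (ℕ._≤ ℕΣ.sum f) (ℕ.+-comm (f zero) (f (suc j)))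
  (ℕ.+-monoʳ-≤ (f zero) (term≤sum (f ∘ suc) j))
pair≤sum f {suc j} {suc k} j≢k = ℕ.≤-trans (pair≤sum (f ∘ suc) (j≢k ∘ cong suc)) (ℕ.m≤n+m _ (f zero))

sum-removeAt≤ : ∀ {n} (f : Fin (suc n) → ℕ) i → ℕΣ.sum (λ j → f (punchIn i j)) ℕ.≤ ℕΣ.sum f
sum-removeAt≤ f i = subst (ℕΣ.sum (λ j → f (punchIn i j)) ℕ.≤_) (sym (ℕΣ.sum-remove {i = i} f)) (ℕ.m≤n+m _ (f i))

prod-cong : ∀ {n} {f g : Fin n → ℕ} → (∀ i → f i ≡ g i) → prodℕ f ≡ prodℕ g
prod-cong {zero}  f≗g = refl
prod-cong {suc n} f≗g = cong₂ ℕ._*_ (f≗g zero) (prod-cong (f≗g ∘ suc))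

prod-mono : ∀ {n} {f g : Fin n → ℕ} → (∀ i → f i ℕ.≤ g i) → prodℕ f ℕ.≤ prodℕ g
prod-mono {zero}  f≤g = ℕ.≤-refl
prod-mono {suc n} f≤g = ℕ.*-mono-≤ (f≤g zero) (prod-mono (f≤g ∘ suc))

prod-^ : ∀ {n} b (e : Fin n → ℕ) → prodℕ (λ i → b ℕ.^ e i) ≡ b ℕ.^ ℕΣ.sum e
prod-^ {zero}  b e = refl
prod-^ {suc n} b e = trans (cong (b ℕ.^ e zero ℕ.*_) (prod-^ b (e ∘ suc))) (sym (ℕ.^-distribˡ-+-* b (e zero) _))

-- Determinants and Schur complements

minor : ∀ {n} → Matrix (suc n) → Fin (suc n) → Matrix n
minor M l i j = M (suc i) (punchIn l j)

laplaceTerm : ∀ {n} → Matrix (suc n) → Fin (suc n) → ℤ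
laplaceTerm M l = (-1ℤ ℤ.^ toℕ l) ℤ.* (M zero l ℤ.* det (minor M l))

det-laplace : ∀ {n} (M : Matrix (suc n)) → det M ≡ ℤΣ.sum (laplaceTerm M)
det-laplace M = sumℤ≡sum (laplaceTerm M)

det-cong : ∀ {n} {M N : Matrix n} → (∀ i j → M i j ≡ N i j) → det M ≡ det N
det-cong {zero}          M≗N = refl
det-cong {suc n} {M} {N} M≗N = begin
  det M                   ≡⟨ det-laplace M ⟩
  ℤΣ.sum (laplaceTerm M)  ≡⟨ ℤΣ.sum-cong-≗ (λ l → cong₂ (λ x y → (-1ℤ ℤ.^ toℕ l) ℤ.* (x ℤ.* y))
                               (M≗N zero l) (det-cong λ i j → M≗N (suc i) (punchIn l j))) ⟩
  ℤΣ.sum (laplaceTerm N)  ≡⟨ det-laplace N ⟨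
  det N                   ∎
  where open ≡-Reasoning

-- The expansion runs along row 0, but linearity is in a column. In the term of column `p` the entry
-- is linear and the minors agree; in the others `p` survives in the minor and induction applies.
det-linear : ∀ {n} {M P Q : Matrix n} (p : Fin n) (a b : ℤ) →
             (∀ i l → l ≢ p → M i l ≡ P i l) → (∀ i l → l ≢ p → M i l ≡ Q i l) →
             (∀ i → M i p ≡ a ℤ.* P i p ℤ.+ b ℤ.* Q i p) →
             det M ≡ a ℤ.* det P ℤ.+ b ℤ.* det Q
det-linear {suc n} {M} {P} {Q} p a b M≗P M≗Q Mp = begin
  det M                                                             ≡⟨ det-laplace M ⟩
  ℤΣ.sum (laplaceTerm M)                                            ≡⟨ sum-linear a b term ⟩
  a ℤ.* ℤΣ.sum (laplaceTerm P) ℤ.+ b ℤ.* ℤΣ.sum (laplaceTerm Q)     ≡⟨ cong₂ (λ x y → a ℤ.* x ℤ.+ b ℤ.* y) (det-laplace P) (det-laplace Q) ⟨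
  a ℤ.* det P ℤ.+ b ℤ.* det Q                                       ∎
  where
  open ≡-Reasoning

  entry-linear : ∀ s x y a b d → s ℤ.* ((a ℤ.* x ℤ.+ b ℤ.* y) ℤ.* d) ≡ a ℤ.* (s ℤ.* (x ℤ.* d)) ℤ.+ b ℤ.* (s ℤ.* (y ℤ.* d))
  entry-linear = ℤ-Solver.solve-∀

  minor-linear : ∀ s x y a b d → s ℤ.* (d ℤ.* (a ℤ.* x ℤ.+ b ℤ.* y)) ≡ a ℤ.* (s ℤ.* (d ℤ.* x)) ℤ.+ b ℤ.* (s ℤ.* (d ℤ.* y))
  minor-linear = ℤ-Solver.solve-∀

  term : ∀ l → laplaceTerm M l ≡ a ℤ.* laplaceTerm P l ℤ.+ b ℤ.* laplaceTerm Q l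
  term l with l ≟ p
  ... | yes refl = begin
    s ℤ.* (M zero l ℤ.* det (minor M l))
      ≡⟨ cong (λ x → s ℤ.* (x ℤ.* det (minor M l))) (Mp zero) ⟩
    s ℤ.* ((a ℤ.* P zero l ℤ.+ b ℤ.* Q zero l) ℤ.* det (minor M l))
      ≡⟨ entry-linear s (P zero l) (Q zero l) a b (det (minor M l)) ⟩
    a ℤ.* (s ℤ.* (P zero l ℤ.* det (minor M l))) ℤ.+ b ℤ.* (s ℤ.* (Q zero l ℤ.* det (minor M l)))
      ≡⟨ cong₂ (λ x y → a ℤ.* (s ℤ.* (P zero l ℤ.* x)) ℤ.+ b ℤ.* (s ℤ.* (Q zero l ℤ.* y)))
           (det-cong λ i j → M≗P (suc i) _ (punchInᵢ≢i l j))
           (det-cong λ i j → M≗Q (suc i) _ (punchInᵢ≢i l j)) ⟩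
    a ℤ.* laplaceTerm P l ℤ.+ b ℤ.* laplaceTerm Q l ∎
    where s = -1ℤ ℤ.^ toℕ l
  ... | no l≢p = begin
    s ℤ.* (M zero l ℤ.* det (minor M l))
      ≡⟨ cong (λ x → s ℤ.* (M zero l ℤ.* x)) (det-linear p′ a b
           (λ i j j≢p′ → M≗P (suc i) _ (off j≢p′)) (λ i j j≢p′ → M≗Q (suc i) _ (off j≢p′))
           (λ i → subst (λ q → M (suc i) q ≡ a ℤ.* P (suc i) q ℤ.+ b ℤ.* Q (suc i) q) (sym eq) (Mp (suc i)))) ⟩
    s ℤ.* (M zero l ℤ.* (a ℤ.* det (minor P l) ℤ.+ b ℤ.* det (minor Q l)))
      ≡⟨ minor-linear s (det (minor P l)) (det (minor Q l)) a b (M zero l) ⟩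
    a ℤ.* (s ℤ.* (M zero l ℤ.* det (minor P l))) ℤ.+ b ℤ.* (s ℤ.* (M zero l ℤ.* det (minor Q l)))
      ≡⟨ cong₂ (λ x y → a ℤ.* (s ℤ.* (x ℤ.* det (minor P l))) ℤ.+ b ℤ.* (s ℤ.* (y ℤ.* det (minor Q l))))
           (M≗P zero l l≢p) (M≗Q zero l l≢p) ⟩
    a ℤ.* laplaceTerm P l ℤ.+ b ℤ.* laplaceTerm Q l ∎
    where
    s  = -1ℤ ℤ.^ toℕ l
    p′ = punchOut l≢p
    eq : punchIn l p′ ≡ p
    eq = punchIn-punchOut l≢p
    off : ∀ {j} → j ≢ p′ → punchIn l j ≢ p
    off {j} j≢p′ lj≡p = j≢p′ (punchIn-injective l j p′ (trans lj≡p (sym eq)))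

punchIn-adjacent : ∀ {n} (p b : Fin n) → punchIn (inject₁ p) b ≡ punchIn (suc p) b ⊎
                   (punchIn (inject₁ p) b ≡ suc p × punchIn (suc p) b ≡ inject₁ p)
punchIn-adjacent zero    zero    = inj₂ (refl , refl)
punchIn-adjacent zero    (suc b) = inj₁ refl
punchIn-adjacent (suc p) zero    = inj₁ refl
punchIn-adjacent (suc p) (suc b) =
  Sum.map (cong suc) (λ (e , e′) → cong suc e , cong suc e′) (punchIn-adjacent p b)

-- Deleting any third column leaves the two adjacent ones adjacent, so that induction on the minor
-- is possible.
punchIn-adjacent⁻¹ : ∀ {n} (l : Fin (suc (suc n))) (p : Fin (suc n)) → l ≢ inject₁ p → l ≢ suc p →
                     ∃ λ p′ → punchIn l (inject₁ p′) ≡ inject₁ p × punchIn l (suc p′) ≡ suc p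
punchIn-adjacent⁻¹         zero          zero    l≢p _    = contradiction refl l≢p
punchIn-adjacent⁻¹         zero          (suc p) _   _    = p , refl , refl
punchIn-adjacent⁻¹         (suc zero)    zero    _   l≢p′ = contradiction refl l≢p′
punchIn-adjacent⁻¹ {suc n} (suc (suc l)) zero    _   _    = zero , refl , refl
punchIn-adjacent⁻¹ {suc n} (suc l)       (suc p) l≢p l≢p′ =
  let p′ , e , e′ = punchIn-adjacent⁻¹ l p (l≢p ∘ cong suc) (l≢p′ ∘ cong suc)
  in suc p′ , cong suc e , cong suc e′

-- Minors that keep both equal columns vanish by induction. The two that drop one of them coincide,
-- and adjacency gives them opposite signs.
det-adjacent : ∀ {n} (M : Matrix (suc n)) (p : Fin n) → (∀ i → M i (inject₁ p) ≡ M i (suc p)) → det M ≡ 0ℤ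
det-adjacent {suc n} M p eq = trans (det-laplace M) (sum-cancelling (laplaceTerm M) p off pair)
  where
  open ≡-Reasoning

  off : ∀ l → l ≢ inject₁ p → l ≢ suc p → laplaceTerm M l ≡ 0ℤ
  off l l≢p l≢p′ = begin
    s ℤ.* (M zero l ℤ.* det (minor M l))
      ≡⟨ cong (λ x → s ℤ.* (M zero l ℤ.* x)) (det-adjacent (minor M l) p′ λ i →
           trans (cong (M (suc i)) e) (trans (eq (suc i)) (cong (M (suc i)) (sym e′)))) ⟩
    s ℤ.* (M zero l ℤ.* 0ℤ) ≡⟨ cong (s ℤ.*_) (ℤ.*-zeroʳ (M zero l)) ⟩
    s ℤ.* 0ℤ                ≡⟨ ℤ.*-zeroʳ s ⟩
    0ℤ                      ∎
    where
    s  = -1ℤ ℤ.^ toℕ l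
    skip = punchIn-adjacent⁻¹ l p l≢p l≢p′
    p′ = skip .proj₁
    e  = skip .proj₂ .proj₁
    e′ = skip .proj₂ .proj₂

  cancel : ∀ s x → s ℤ.* x ℤ.+ (-1ℤ ℤ.* s) ℤ.* x ≡ 0ℤ
  cancel = ℤ-Solver.solve-∀

  minor≗ : ∀ i j → minor M (suc p) i j ≡ minor M (inject₁ p) i j
  minor≗ i j with punchIn-adjacent p j
  ... | inj₁ e        = cong (M (suc i)) (sym e)
  ... | inj₂ (e , e′) = trans (cong (M (suc i)) e′) (trans (eq (suc i)) (cong (M (suc i)) (sym e)))

  pair : laplaceTerm M (inject₁ p) ℤ.+ laplaceTerm M (suc p) ≡ 0ℤ
  pair = begin
    laplaceTerm M (inject₁ p) ℤ.+ laplaceTerm M (suc p)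
      ≡⟨ cong₂ (λ t x → laplaceTerm M (inject₁ p) ℤ.+ (-1ℤ ℤ.* (-1ℤ ℤ.^ t)) ℤ.* x)
           (sym (toℕ-inject₁ p)) (cong₂ ℤ._*_ (sym (eq zero)) (det-cong minor≗)) ⟩
    _ ≡⟨ cancel (-1ℤ ℤ.^ toℕ (inject₁ p)) _ ⟩
    0ℤ ∎

setColumn : ∀ {n} → Matrix n → Fin n → (Fin n → ℤ) → Matrix n
setColumn M p c i = updateAt (M i) p (const (c i))

setColumn-at : ∀ {n} (M : Matrix n) p c i → setColumn M p c i p ≡ c i
setColumn-at M p c i = updateAt-updates p (M i)

setColumn-off : ∀ {n} (M : Matrix n) p c i {l} → l ≢ p → setColumn M p c i l ≡ M i l
setColumn-off M p c i {l} l≢p = updateAt-minimal l p (M i) l≢p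

-- By induction on j: putting x + u in the last two columns x, u makes them adjacent and equal,
-- and the expansion of that vanishing determinant leaves only the given one.
det-repeated : ∀ {n} (M : Matrix (suc n)) (j : Fin n) → (∀ i → M i zero ≡ M i (suc j)) → det M ≡ 0ℤ
det-repeated M j eq = go (toℕ j) M j refl eq
  where
  -- The recursive call is at `inject₁ j`, which is no structural part of `suc j`; hence the
  -- recursion on its value `m`.
  go : ∀ m {n} (M : Matrix (suc n)) (j : Fin n) → toℕ j ≡ m → (∀ i → M i zero ≡ M i (suc j)) → det M ≡ 0ℤ
  go _       M zero    _    eq = det-adjacent M zero eq
  go (suc m) M (suc j) j≡m eq = begin
    det M                                                            ≡⟨ identity (det M) ⟩
    1ℤ ℤ.* (1ℤ ℤ.* 0ℤ ℤ.+ 1ℤ ℤ.* det M) ℤ.+ 1ℤ ℤ.* 0ℤ                ≡⟨ cong₂ (λ x y → 1ℤ ℤ.* (1ℤ ℤ.* x ℤ.+ 1ℤ ℤ.* det M) ℤ.+ 1ℤ ℤ.* y) xx≡0 us≡0 ⟨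
    1ℤ ℤ.* (1ℤ ℤ.* det (D x x) ℤ.+ 1ℤ ℤ.* det M) ℤ.+ 1ℤ ℤ.* det (D u s) ≡⟨ cong (λ y → 1ℤ ℤ.* y ℤ.+ 1ℤ ℤ.* det (D u s)) split-q ⟨
    1ℤ ℤ.* det (D x s) ℤ.+ 1ℤ ℤ.* det (D u s)                        ≡⟨ split-p ⟨
    det (D s s)                                                      ≡⟨ ss≡0 ⟩
    0ℤ                                                               ∎
    where
    open ≡-Reasoning
    p = inject₁ (suc j)
    q = suc (suc j)

    p≢q : p ≢ q
    p≢q p≡q = ℕ.1+n≢n (sym (trans (sym (toℕ-inject₁ (suc j))) (cong toℕ p≡q)))

    x u s : Fin _ → ℤ
    x i = M i p
    u i = M i q
    s i = x i ℤ.+ u i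

    D : (a b : Fin _ → ℤ) → Matrix _
    D a b = setColumn (setColumn M p a) q b

    D-q : ∀ a b i → D a b i q ≡ b i
    D-q a b = setColumn-at (setColumn M p a) q b

    D-p : ∀ a b i → D a b i p ≡ a i
    D-p a b i = trans (setColumn-off (setColumn M p a) q b i p≢q) (setColumn-at M p a i)

    D-off : ∀ a b {l} i → l ≢ p → l ≢ q → D a b i l ≡ M i l
    D-off a b i l≢p l≢q = trans (setColumn-off (setColumn M p a) q b i l≢q) (setColumn-off M p a i l≢p)

    D-off-p : ∀ a a′ b i l → l ≢ p → D a b i l ≡ D a′ b i l
    D-off-p a a′ b i l l≢p with l ≟ q
    ... | yes refl = trans (D-q a b i) (sym (D-q a′ b i))
    ... | no l≢q   = trans (D-off a b i l≢p l≢q) (sym (D-off a′ b i l≢p l≢q))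

    D-off-q : ∀ a b b′ i l → l ≢ q → D a b i l ≡ D a b′ i l
    D-off-q a b b′ i l l≢q = trans (setColumn-off (setColumn M p a) q b i l≢q) (sym (setColumn-off (setColumn M p a) q b′ i l≢q))

    D-off-q-M : ∀ b i l → l ≢ q → D x b i l ≡ M i l
    D-off-q-M b i l l≢q with l ≟ p
    ... | yes refl = D-p x b i
    ... | no l≢p   = D-off x b i l≢p l≢q

    identity : ∀ d → d ≡ 1ℤ ℤ.* (1ℤ ℤ.* 0ℤ ℤ.+ 1ℤ ℤ.* d) ℤ.+ 1ℤ ℤ.* 0ℤ
    identity = ℤ-Solver.solve-∀

    unit : ∀ y z → y ℤ.+ z ≡ 1ℤ ℤ.* y ℤ.+ 1ℤ ℤ.* z
    unit = ℤ-Solver.solve-∀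

    ss≡0 : det (D s s) ≡ 0ℤ
    ss≡0 = det-adjacent (D s s) (suc j) λ i → trans (D-p s s i) (sym (D-q s s i))

    xx≡0 : det (D x x) ≡ 0ℤ
    xx≡0 = det-adjacent (D x x) (suc j) λ i → trans (D-p x x i) (sym (D-q x x i))

    -- `u` is the copy of column 0; here it stands at `p`, one place nearer to column 0.
    us≡0 : det (D u s) ≡ 0ℤ
    us≡0 = go m (D u s) (inject₁ j) (trans (toℕ-inject₁ j) (ℕ.suc-injective j≡m)) λ i →
      trans (D-off u s i (λ ()) (λ ())) (trans (eq i) (sym (D-p u s i)))

    split-p : det (D s s) ≡ 1ℤ ℤ.* det (D x s) ℤ.+ 1ℤ ℤ.* det (D u s)
    split-p = det-linear p 1ℤ 1ℤ (D-off-p s x s) (D-off-p s u s) λ i →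
      trans (D-p s s i) (trans (unit (x i) (u i))
        (cong₂ (λ y z → 1ℤ ℤ.* y ℤ.+ 1ℤ ℤ.* z) (sym (D-p x s i)) (sym (D-p u s i))))

    split-q : det (D x s) ≡ 1ℤ ℤ.* det (D x x) ℤ.+ 1ℤ ℤ.* det M
    split-q = det-linear q 1ℤ 1ℤ (D-off-q x s x) (D-off-q-M s) λ i →
      trans (D-q x s i) (trans (unit (x i) (u i))
        (cong (λ y → 1ℤ ℤ.* y ℤ.+ 1ℤ ℤ.* u i) (sym (D-q x x i))))

-- Division-free column elimination

module _ {n} (M : Matrix (suc n)) where
  private
    a = M zero zero

  eliminated : Fin (suc n) → Fin n → ℤ
  eliminated i j = a ℤ.* M i (suc j) ℤ.- M zero (suc j) ℤ.* M i zero

  -- The Schur complement of the corner entry, multiplied by the pivot to remain integral.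
  schur : Matrix n
  schur i j = eliminated (suc i) j

  partiallyEliminated : ℕ → Matrix (suc n)
  partiallyEliminated m i zero = M i zero
  partiallyEliminated m i (suc j) with toℕ j ℕ.<? m
  ... | yes _ = eliminated i j
  ... | no  _ = M i (suc j)

  done : ∀ {m} i j → toℕ j ℕ.< m → partiallyEliminated m i (suc j) ≡ eliminated i j
  done {m} i j j<m with toℕ j ℕ.<? m
  ... | yes _  = refl
  ... | no j≮m = contradiction j<m j≮m

  todo : ∀ {m} i j → m ℕ.≤ toℕ j → partiallyEliminated m i (suc j) ≡ M i (suc j)
  todo {m} i j m≤j with toℕ j ℕ.<? m
  ... | yes j<m = contradiction m≤j (ℕ.<⇒≱ j<m)
  ... | no _    = refl

  -- The new column is `a` times the old one minus a multiple of column 0, and the latter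
  -- contributes a determinant with a repeated column.
  det-step : ∀ m → m ℕ.< n → det (partiallyEliminated (suc m)) ≡ a ℤ.* det (partiallyEliminated m)
  det-step m m<n = begin
    det N′                                       ≡⟨ det-linear (suc p) a (- M zero (suc p)) agree-N agree-R column ⟩
    a ℤ.* det N ℤ.+ - M zero (suc p) ℤ.* det R   ≡⟨ cong (λ d → a ℤ.* det N ℤ.+ - M zero (suc p) ℤ.* d) R≡0 ⟩
    a ℤ.* det N ℤ.+ - M zero (suc p) ℤ.* 0ℤ      ≡⟨ cong (ℤ._+_ (a ℤ.* det N)) (ℤ.*-zeroʳ (- M zero (suc p))) ⟩
    a ℤ.* det N ℤ.+ 0ℤ                           ≡⟨ ℤ.+-identityʳ (a ℤ.* det N) ⟩
    a ℤ.* det N                                  ∎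
    where
    open ≡-Reasoning
    p  = Fin.fromℕ< m<n
    N  = partiallyEliminated m
    N′ = partiallyEliminated (suc m)
    firstColumn : Fin (suc n) → ℤ
    firstColumn i = M i zero
    R  = setColumn N (suc p) firstColumn

    p≡m : toℕ p ≡ m
    p≡m = Fin.toℕ-fromℕ< m<n

    agree-N : ∀ i l → l ≢ suc p → N′ i l ≡ N i l
    agree-N i zero    _   = refl
    agree-N i (suc j) j≢p with ℕ.<-cmp (toℕ j) m
    ... | tri< j<m _ _ = trans (done i j (ℕ.m<n⇒m<1+n j<m)) (sym (done i j j<m))
    ... | tri≈ _ j≡m _ = contradiction (cong suc (Fin.toℕ-injective (trans j≡m (sym p≡m)))) j≢p
    ... | tri> _ _ m<j = trans (todo i j m<j) (sym (todo i j (ℕ.<⇒≤ m<j)))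

    agree-R : ∀ i l → l ≢ suc p → N′ i l ≡ R i l
    agree-R i l l≢p = trans (agree-N i l l≢p) (sym (setColumn-off N (suc p) firstColumn i l≢p))

    negate : ∀ w x y z → w ℤ.* x ℤ.- y ℤ.* z ≡ w ℤ.* x ℤ.+ - y ℤ.* z
    negate = ℤ-Solver.solve-∀

    column : ∀ i → N′ i (suc p) ≡ a ℤ.* N i (suc p) ℤ.+ - M zero (suc p) ℤ.* R i (suc p)
    column i = begin
      N′ i (suc p)    ≡⟨ done i p (ℕ.s≤s (ℕ.≤-reflexive p≡m)) ⟩
      eliminated i p  ≡⟨ negate a (M i (suc p)) (M zero (suc p)) (M i zero) ⟩
      a ℤ.* M i (suc p) ℤ.+ - M zero (suc p) ℤ.* M i zero
                      ≡⟨ cong₂ (λ y z → a ℤ.* y ℤ.+ - M zero (suc p) ℤ.* z)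
                           (sym (todo i p (ℕ.≤-reflexive (sym p≡m)))) (sym (setColumn-at N (suc p) firstColumn i)) ⟩
      a ℤ.* N i (suc p) ℤ.+ - M zero (suc p) ℤ.* R i (suc p) ∎

    R≡0 : det R ≡ 0ℤ
    R≡0 = det-repeated R p λ i → trans (setColumn-off N (suc p) firstColumn i {zero} λ ()) (sym (setColumn-at N (suc p) firstColumn i))

  det-partiallyEliminated : ∀ m → m ℕ.≤ n → det (partiallyEliminated m) ≡ a ℤ.^ m ℤ.* det M
  det-partiallyEliminated zero    _   = trans (det-cong unchanged) (sym (ℤ.*-identityˡ (det M)))
    where
    unchanged : ∀ i l → partiallyEliminated 0 i l ≡ M i l
    unchanged i zero    = refl
    unchanged i (suc j) = todo i j ℕ.z≤n
  det-partiallyEliminated (suc m) m<n = begin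
    det (partiallyEliminated (suc m))      ≡⟨ det-step m m<n ⟩
    a ℤ.* det (partiallyEliminated m)      ≡⟨ cong (a ℤ.*_) (det-partiallyEliminated m (ℕ.<⇒≤ m<n)) ⟩
    a ℤ.* (a ℤ.^ m ℤ.* det M)              ≡⟨ ℤ.*-assoc a (a ℤ.^ m) (det M) ⟨
    a ℤ.^ suc m ℤ.* det M                  ∎
    where open ≡-Reasoning

  -- After the elimination row 0 is `a` followed by zeros. The common factor `a` stays on both sides
  -- because cancelling it would need the exponent n - 1.
  det-schur : a ℤ.^ n ℤ.* det M ≡ a ℤ.* det schur
  det-schur = begin
    a ℤ.^ n ℤ.* det M                                            ≡⟨ det-partiallyEliminated n ℕ.≤-refl ⟨
    det N                                                        ≡⟨ det-laplace N ⟩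
    1ℤ ℤ.* (a ℤ.* det (minor N zero)) ℤ.+ ℤΣ.sum (laplaceTerm N ∘ suc) ≡⟨ cong₂ ℤ._+_ (ℤ.*-identityˡ (a ℤ.* det (minor N zero))) (sum-zero vanish) ⟩
    a ℤ.* det (minor N zero) ℤ.+ 0ℤ                              ≡⟨ ℤ.+-identityʳ (a ℤ.* det (minor N zero)) ⟩
    a ℤ.* det (minor N zero)                                     ≡⟨ cong (a ℤ.*_) (det-cong λ i j → done (suc i) j (Fin.toℕ<n j)) ⟩
    a ℤ.* det schur                                              ∎
    where
    open ≡-Reasoning
    N = partiallyEliminated n

    commute : ∀ s x y z → s ℤ.* ((x ℤ.* y ℤ.- y ℤ.* x) ℤ.* z) ≡ 0ℤ
    commute = ℤ-Solver.solve-∀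

    vanish : ∀ j → laplaceTerm N (suc j) ≡ 0ℤ
    vanish j = trans
      (cong (λ y → (-1ℤ ℤ.^ suc (toℕ j)) ℤ.* (y ℤ.* det (minor N (suc j)))) (done zero j (Fin.toℕ<n j)))
      (commute (-1ℤ ℤ.^ suc (toℕ j)) a (M zero (suc j)) (det (minor N (suc j))))

-- Matrices with nonpositive off-diagonal entries and positive principal minors

nonpos-∣∣ : ∀ {x} → x ℤ.≤ 0ℤ → + ∣ x ∣ ≡ - x
nonpos-∣∣ {x} x≤0 = trans (cong +_ (sym (ℤ.∣-i∣≡∣i∣ x))) (ℤ.0≤i⇒+∣i∣≡i (ℤ.neg-mono-≤ x≤0))

-i≤∣i∣ : ∀ x → - x ℤ.≤ + ∣ x ∣
-i≤∣i∣ (+ zero)     = ℤ.≤-refl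
-i≤∣i∣ (+ suc n)    = ℤ.-≤+
-i≤∣i∣ (ℤ.-[1+ n ]) = ℤ.≤-refl

*-pos : ∀ {x y} → 0ℤ ℤ.< x → 0ℤ ℤ.< y → 0ℤ ℤ.< x ℤ.* y
*-pos (ℤ.+<+ (ℕ.s≤s _)) (ℤ.+<+ (ℕ.s≤s _)) = ℤ.+<+ ℕ.z<s

*-pos-cancelˡ : ∀ {x y} → 0ℤ ℤ.< x → 0ℤ ℤ.< x ℤ.* y → 0ℤ ℤ.< y
*-pos-cancelˡ {+ suc m} {y} (ℤ.+<+ _) 0<xy =
  ℤ.*-cancelˡ-<-nonNeg (+ suc m) (subst (ℤ._< + suc m ℤ.* y) (sym (ℤ.*-zeroʳ (+ suc m))) 0<xy)
*-pos-cancelˡ {+ zero} (ℤ.+<+ ()) _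

^-pos : ∀ {x} n → 0ℤ ℤ.< x → 0ℤ ℤ.< x ℤ.^ n
^-pos zero    0<x = ℤ.+<+ ℕ.z<s
^-pos (suc n) 0<x = *-pos 0<x (^-pos n 0<x)

lift : ∀ {k n} → (Fin k → Fin n) → Fin (suc k) → Fin (suc n)
lift f zero    = zero
lift f (suc i) = suc (f i)

lift-increasing : ∀ {k n} {f : Fin k → Fin n} → StrictlyIncreasing f → StrictlyIncreasing (lift f)
lift-increasing f< zero    (suc b) _           = ℕ.z<s
lift-increasing f< (suc a) (suc b) (ℕ.s<s a<b) = ℕ.s<s (f< a b a<b)

finiteType-corner : ∀ {n} (A : Matrix (suc n)) → FiniteType A → 0ℤ ℤ.< A zero zero
finiteType-corner A ft = subst (0ℤ ℤ.<_) (identity (A zero zero)) (ft 1 (λ _ → zero) λ { zero zero () })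
  where
  identity : ∀ x → 1ℤ ℤ.* (x ℤ.* 1ℤ) ℤ.+ 0ℤ ≡ x
  identity = ℤ-Solver.solve-∀

-- A principal submatrix of `schur A` is, definitionally, the `schur` of a principal submatrix of
-- `A` that contains index 0; `lift f` selects the latter.
finiteType-schur : ∀ {n} (A : Matrix (suc n)) → FiniteType A → FiniteType (schur A)
finiteType-schur A ft k f f< = *-pos-cancelˡ (finiteType-corner A ft)
  (subst (0ℤ ℤ.<_) (det-schur (λ a b → A (lift f a) (lift f b)))
    (*-pos (^-pos k (finiteType-corner A ft)) (ft (suc k) (lift f) (lift-increasing f<))))

ZMatrix : ∀ {n} → Matrix n → Set
ZMatrix A = ∀ i j → i ≢ j → A i j ℤ.≤ 0ℤ

neg*nonneg : ∀ {x} n → x ℤ.≤ 0ℤ → x ℤ.* + n ℤ.≤ 0ℤ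
neg*nonneg {x} n x≤0 = ℤ.*-monoʳ-≤-nonNeg (+ n) x≤0

-- Apart from scaling by a positive pivot, elimination subtracts a product of two nonpositive
-- entries, so it can only lower an off-diagonal entry.
zmatrix-schur : ∀ {n} (A : Matrix (suc n)) → 0ℤ ℤ.< A zero zero → ZMatrix A → ZMatrix (schur A)
zmatrix-schur A 0<a z i j i≢j = ℤ.+-mono-≤
  (subst (ℤ._≤ 0ℤ) (ℤ.*-comm x a) (subst (λ a → x ℤ.* a ℤ.≤ 0ℤ) (ℤ.0≤i⇒+∣i∣≡i (ℤ.<⇒≤ 0<a)) (neg*nonneg ∣ a ∣ (z (suc i) (suc j) (i≢j ∘ Fin.suc-injective)))))
  (subst (ℤ._≤ 0ℤ) (trans (cong (y ℤ.*_) (nonpos-∣∣ (z (suc i) zero λ ()))) (sym (ℤ.neg-distribʳ-* y _)))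
    (neg*nonneg ∣ A (suc i) zero ∣ (z zero (suc j) λ ())))
  where
  a = A zero zero
  x = A (suc i) (suc j)
  y = A zero (suc j)

infixl 7 _·_
_·_ : ∀ {n} → Matrix n → (Fin n → ℕ) → Fin n → ℤ
(A · v) i = ℤΣ.sum (λ j → A i j ℤ.* + v j)

-- Gaussian elimination: a positive solution w for the Schur complement extends to A
-- by solving row 0 exactly, up to a perturbation + 1 that is dominated after scaling by K.
finiteType⇒positive : ∀ {n} (A : Matrix n) → ZMatrix A → FiniteType A →
                      ∃ λ v → (∀ i → 0 ℕ.< v i) × (∀ i → 0ℤ ℤ.< (A · v) i)
finiteType⇒positive {zero}  A z ft = (λ ()) , (λ ()) , (λ ())
finiteType⇒positive {suc n} A z ft = v , v>0 , Av>0
  where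
  open ≡-Reasoning
  a = A zero zero
  α = ∣ a ∣
  0<a : 0ℤ ℤ.< a
  0<a = finiteType-corner A ft

  α≡a : + α ≡ a
  α≡a = ℤ.0≤i⇒+∣i∣≡i (ℤ.<⇒≤ 0<a)

  rec = finiteType⇒positive (schur A) (zmatrix-schur A 0<a z) (finiteType-schur A ft)
  w    = rec .proj₁
  w>0  = rec .proj₂ .proj₁
  Aw>0 = rec .proj₂ .proj₂

  row : Fin (suc n) → ℤ
  row i = ℤΣ.sum (λ j → A i (suc j) ℤ.* + w j)

  row0≤0 : row zero ℤ.≤ 0ℤ
  row0≤0 = sum-nonpos λ j → neg*nonneg (w j) (z zero (suc j) λ ())

  σ = ∣ row zero ∣
  -- Exceeds every `∣ A (suc i) zero ∣`, the largest loss that the perturbation can cause in row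
  -- `suc i`; against it stands `K` times `(schur A · w) i`, which is at least 1.
  K = suc (ℕΣ.sum (λ i → ∣ A (suc i) zero ∣))

  v : Fin (suc n) → ℕ
  v zero    = suc (K ℕ.* σ)
  v (suc j) = α ℕ.* K ℕ.* w j

  v>0 : ∀ i → 0 ℕ.< v i
  v>0 zero    = ℕ.z<s
  v>0 (suc j) = ℕ.*-mono-≤ (ℕ.*-mono-≤ (ℤ.drop‿+<+ (subst (0ℤ ℤ.<_) (sym α≡a) 0<a)) (ℕ.s≤s ℕ.z≤n)) (w>0 j)

  reassoc : ∀ x y z w → x ℤ.* (y ℤ.* z ℤ.* w) ≡ (y ℤ.* z) ℤ.* (x ℤ.* w)
  reassoc = ℤ-Solver.solve-∀

  Av : ∀ i → (A · v) i ≡ A i zero ℤ.* (1ℤ ℤ.+ + K ℤ.* - row zero) ℤ.+ a ℤ.* + K ℤ.* row i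
  Av i = cong₂ ℤ._+_
    (cong (λ x → A i zero ℤ.* (1ℤ ℤ.+ x)) (trans (ℤ.pos-* K σ) (cong (+ K ℤ.*_) (nonpos-∣∣ row0≤0))))
    (trans (ℤΣ.sum-cong-≗ λ j → trans
        (cong (A i (suc j) ℤ.*_) (trans (ℤ.pos-* (α ℕ.* K) (w j)) (cong (ℤ._* + w j) (trans (ℤ.pos-* α K) (cong (ℤ._* + K) α≡a)))))
        (reassoc (A i (suc j)) a (+ K) (+ w j)))
      (sym (ℤΣ.*-distribˡ-sum (a ℤ.* + K) (λ j → A i (suc j) ℤ.* + w j))))

  row-zero : ∀ a k r → a ℤ.* (1ℤ ℤ.+ k ℤ.* - r) ℤ.+ a ℤ.* k ℤ.* r ≡ a
  row-zero = ℤ-Solver.solve-∀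

  row-suc : ∀ b a k r s → b ℤ.* (1ℤ ℤ.+ k ℤ.* - r) ℤ.+ a ℤ.* k ℤ.* s ≡ b ℤ.+ k ℤ.* (a ℤ.* s ℤ.+ - b ℤ.* r)
  row-suc = ℤ-Solver.solve-∀

  schur-row : ∀ a x y b w → (a ℤ.* x ℤ.- y ℤ.* b) ℤ.* w ≡ a ℤ.* (x ℤ.* w) ℤ.+ - b ℤ.* (y ℤ.* w)
  schur-row = ℤ-Solver.solve-∀

  schur·w : ∀ i → (schur A · w) i ≡ a ℤ.* row (suc i) ℤ.+ - A (suc i) zero ℤ.* row zero
  schur·w i = sum-linear a (- A (suc i) zero) λ j →
    schur-row a (A (suc i) (suc j)) (A zero (suc j)) (A (suc i) zero) (+ w j)

  Av>0 : ∀ i → 0ℤ ℤ.< (A · v) i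
  Av>0 zero    = subst (0ℤ ℤ.<_) (sym (trans (Av zero) (row-zero a (+ K) (row zero)))) 0<a
  Av>0 (suc i) = subst (0ℤ ℤ.<_) (sym (trans (Av (suc i)) (trans
      (row-suc b a (+ K) (row zero) (row (suc i))) (cong (λ s → b ℤ.+ + K ℤ.* s) (sym (schur·w i))))))
    (ℤ.<-≤-trans
      (subst (ℤ._< b ℤ.+ + K) (ℤ.+-inverseʳ b)
        (ℤ.+-monoʳ-< b (ℤ.≤-<-trans (-i≤∣i∣ b) (ℤ.+<+ (ℕ.s≤s (term≤sum (λ i → ∣ A (suc i) zero ∣) i))))))
      (ℤ.+-monoʳ-≤ b (subst (ℤ._≤ + K ℤ.* (schur A · w) i) (ℤ.*-identityʳ (+ K))
        (ℤ.*-monoˡ-≤-nonNeg (+ K) (ℤ.i<j⇒suc[i]≤j (Aw>0 i))))))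
    where
    b = A (suc i) zero

-- These are the exponents of the frieze relation. The zero diagonal lets a product over all rows be
-- written without excluding the row itself.
offDiagonal : ∀ {n} → Matrix n → Fin n → Fin n → ℕ
offDiagonal A i j with i ≟ j
... | yes _ = 0
... | no  _ = ∣ A i j ∣

offDiagonal-diag : ∀ {n} (A : Matrix n) i → offDiagonal A i i ≡ 0
offDiagonal-diag A i with i ≟ i
... | yes _  = refl
... | no i≢i = contradiction refl i≢i

offDiagonal-≢ : ∀ {n} (A : Matrix n) {i j} → i ≢ j → offDiagonal A i j ≡ ∣ A i j ∣
offDiagonal-≢ A {i} {j} i≢j with i ≟ j
... | yes i≡j = contradiction i≡j i≢j
... | no _    = refl

-- `A` is twice the identity minus `offDiagonal A`, so this is positivity of `A · v` rearranged.
offDiagonal-dominated : ∀ {n} (A : Matrix n) → IsCartan A → (v : Fin n → ℕ) → (∀ i → 0ℤ ℤ.< (A · v) i) →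
                        ∀ i → ℕΣ.sum (λ j → offDiagonal A i j ℕ.* v j) ℕ.< 2 ℕ.* v i
offDiagonal-dominated A cartan v Av>0 i = ℤ.drop‿+<+ (subst₂ ℤ._<_ (ℤ.+-identityˡ (+ s)) total
  (ℤ.+-monoˡ-< (+ s) (Av>0 i)))
  where
  open IsCartan cartan
  open ≡-Reasoning
  c = offDiagonal A i
  s = ℕΣ.sum (λ j → c j ℕ.* v j)

  term : Fin _ → ℤ
  term j = A i j ℤ.* + v j ℤ.+ + (c j ℕ.* v j)

  cancel : ∀ x y → x ℤ.* y ℤ.+ - x ℤ.* y ≡ 0ℤ
  cancel = ℤ-Solver.solve-∀

  off : ∀ j → j ≢ i → term j ≡ 0ℤ
  off j j≢i = begin
    A i j ℤ.* + v j ℤ.+ + (c j ℕ.* v j)           ≡⟨ cong (ℤ._+_ (A i j ℤ.* + v j)) (ℤ.pos-* (c j) (v j)) ⟩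
    A i j ℤ.* + v j ℤ.+ + c j ℤ.* + v j           ≡⟨ cong (λ x → A i j ℤ.* + v j ℤ.+ x ℤ.* + v j)
                                                     (trans (cong +_ (offDiagonal-≢ A (j≢i ∘ sym))) (nonpos-∣∣ (offdiag i j (j≢i ∘ sym)))) ⟩
    A i j ℤ.* + v j ℤ.+ - A i j ℤ.* + v j         ≡⟨ cancel (A i j) (+ v j) ⟩
    0ℤ                                            ∎

  total : (A · v) i ℤ.+ + s ≡ + (2 ℕ.* v i)
  total = begin
    (A · v) i ℤ.+ + s                                       ≡⟨ cong (ℤ._+_ ((A · v) i)) (pos-sum (λ j → c j ℕ.* v j)) ⟩
    (A · v) i ℤ.+ ℤΣ.sum (λ j → + (c j ℕ.* v j))            ≡⟨ ℤΣ.∑-distrib-+ (λ j → A i j ℤ.* + v j) (λ j → + (c j ℕ.* v j)) ⟨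
    ℤΣ.sum term                                             ≡⟨ sum-single term i off ⟩
    A i i ℤ.* + v i ℤ.+ + (c i ℕ.* v i)                     ≡⟨ cong₂ (λ x y → x ℤ.* + v i ℤ.+ + (y ℕ.* v i)) (diag i) (offDiagonal-diag A i) ⟩
    + 2 ℤ.* + v i ℤ.+ 0ℤ                                    ≡⟨ ℤ.+-identityʳ (+ 2 ℤ.* + v i) ⟩
    + 2 ℤ.* + v i                                           ≡⟨ ℤ.pos-* 2 (v i) ⟨
    + (2 ℕ.* v i)                                           ∎

-- Potentials on the Dynkin diagram

minimum : ∀ {n} (v : Fin (suc n) → ℕ) → ∃ λ i → ∀ j → v i ℕ.≤ v j
minimum {zero}  v = zero , λ { zero → ℕ.≤-refl }
minimum {suc n} v with minimum (v ∘ suc)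
... | i , least with v zero ℕ.≤? v (suc i)
...   | yes v₀≤vᵢ = zero , λ { zero → ℕ.≤-refl ; (suc j) → ℕ.≤-trans v₀≤vᵢ (least j) }
...   | no  v₀≰vᵢ = suc i , λ { zero → ℕ.<⇒≤ (ℕ.≰⇒> v₀≰vᵢ) ; (suc j) → least j }

Dominated : ∀ {n} → (Fin n → Fin n → ℕ) → (Fin n → ℕ) → Set
Dominated c v = ∀ i → ℕΣ.sum (λ j → c i j ℕ.* v j) ℕ.< 2 ℕ.* v i

-- By minimality each neighbour contributes at least `v i` to the sum, so two of them would already
-- reach `2 v i`.
atMostOneNeighbour : ∀ {n} (c : Fin n → Fin n → ℕ) (v : Fin n → ℕ) → Dominated c v →
                     ∀ i → (∀ j → v i ℕ.≤ v j) → ∀ j k → c i j ≢ 0 → c i k ≢ 0 → j ≡ k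
atMostOneNeighbour c v dom i least j k cj≢0 ck≢0 = decidable-stable (j ≟ k) λ j≢k →
  ℕ.<⇒≱ (dom i) (begin
    2 ℕ.* v i                       ≡⟨ cong (v i ℕ.+_) (ℕ.+-identityʳ (v i)) ⟩
    v i ℕ.+ v i                     ≤⟨ ℕ.+-mono-≤ (bound j cj≢0) (bound k ck≢0) ⟩
    c i j ℕ.* v j ℕ.+ c i k ℕ.* v k ≤⟨ pair≤sum (λ j → c i j ℕ.* v j) j≢k ⟩
    ℕΣ.sum (λ j → c i j ℕ.* v j)    ∎)
  where
  open ℕ.≤-Reasoning
  bound : ∀ l → c i l ≢ 0 → v i ℕ.≤ c i l ℕ.* v l
  bound l cl≢0 = ℕ.≤-trans (least l) (ℕ.m≤n*m (v l) (c i l) {{ℕ.≢-nonZero cl≢0}})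

-- A vertex minimising v is a leaf of the graph of c, so the graph is a forest
-- and the increments o can be integrated along its edges by adding one leaf at a time.
potential : ∀ {n} (c : Fin n → Fin n → ℕ) (o : Fin n → Fin n → ℤ) (v : Fin n → ℕ) →
            (∀ i → c i i ≡ 0) → (∀ i j → c i j ≡ 0 → c j i ≡ 0) → (∀ i j → o j i ≡ - o i j) →
            Dominated c v → ∃ λ (s : Fin n → ℤ) → ∀ i j → c i j ≢ 0 → s i ≡ s j ℤ.+ o i j
potential {zero}  c o v c-diag c-sym o-anti dom = (λ ()) , λ ()
potential {suc n} c o v c-diag c-sym o-anti dom = s , s-edge
  where
  leaf = proj₁ (minimum v)

  rec = potential (λ i j → c (punchIn leaf i) (punchIn leaf j)) (λ i j → o (punchIn leaf i) (punchIn leaf j))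
    (v ∘ punchIn leaf) (λ i → c-diag _) (λ i j → c-sym _ _) (λ i j → o-anti _ _)
    (λ i → ℕ.≤-<-trans (sum-removeAt≤ (λ j → c (punchIn leaf i) j ℕ.* v j) leaf) (dom (punchIn leaf i)))
  s′ = proj₁ rec

  leafValue : ∃ λ x → ∀ j → c leaf (punchIn leaf j) ≢ 0 → x ≡ s′ j ℤ.+ o leaf (punchIn leaf j)
  leafValue with Fin.any? (λ j → ¬? (c leaf (punchIn leaf j) ℕ.≟ 0))
  -- No edge constrains an isolated vertex; 0 is an arbitrary choice.
  ... | no isolated = 0ℤ , λ j cj≢0 → contradiction (j , cj≢0) isolated
  ... | yes (k , ck≢0) = s′ k ℤ.+ o leaf (punchIn leaf k) , λ j cj≢0 →
    cong (λ l → s′ l ℤ.+ o leaf (punchIn leaf l))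
      (punchIn-injective leaf k j (atMostOneNeighbour c v dom leaf (proj₂ (minimum v)) _ _ ck≢0 cj≢0))
  x = proj₁ leafValue

  s : Fin (suc n) → ℤ
  s = insertAt s′ leaf x

  s-leaf : s leaf ≡ x
  s-leaf = insertAt-lookup s′ leaf x

  s-other : ∀ j → s (punchIn leaf j) ≡ s′ j
  s-other = insertAt-punchIn s′ leaf x

  reverse : ∀ {y z} o → y ≡ z ℤ.+ o → z ≡ y ℤ.+ - o
  reverse {_} {z} o refl = identity z o
    where
    identity : ∀ z o → z ≡ z ℤ.+ o ℤ.+ - o
    identity = ℤ-Solver.solve-∀

  leaf-edge : ∀ j → c leaf (punchIn leaf j) ≢ 0 → s leaf ≡ s (punchIn leaf j) ℤ.+ o leaf (punchIn leaf j)
  leaf-edge j cj≢0 = trans s-leaf (trans (proj₂ leafValue j cj≢0)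
    (cong (ℤ._+ o leaf (punchIn leaf j)) (sym (s-other j))))

  s-edge : ∀ i j → c i j ≢ 0 → s i ≡ s j ℤ.+ o i j
  s-edge i j cij≢0 with leaf ≟ i | leaf ≟ j
  ... | yes refl | yes refl = contradiction (c-diag leaf) cij≢0
  ... | yes refl | no  l≢j  = subst (λ j → c i j ≢ 0 → s i ≡ s j ℤ.+ o i j) (punchIn-punchOut l≢j)
    (leaf-edge (punchOut l≢j)) cij≢0
  ... | no  l≢i  | yes refl = subst (λ i → c i leaf ≢ 0 → s i ≡ s leaf ℤ.+ o i leaf) (punchIn-punchOut l≢i)
    (λ c≢0 → trans (reverse _ (leaf-edge (punchOut l≢i) (c≢0 ∘ c-sym _ _)))
      (cong (ℤ._+_ (s leaf)) (sym (o-anti leaf _)))) cij≢0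
  ... | no  l≢i  | no  l≢j  = subst₂ (λ i j → c i j ≢ 0 → s i ≡ s j ℤ.+ o i j) (punchIn-punchOut l≢i) (punchIn-punchOut l≢j)
    (λ c≢0 → trans (s-other _) (trans (proj₂ rec _ _ c≢0) (cong (ℤ._+ o _ _) (sym (s-other _))))) cij≢0

-- The weights n (2K + 1 - n) form a concave sequence vanishing at n = 0 and n = 2K + 1, concave enough to
-- be a supersolution of q (n + 2) + q n = (2 - 1/K) q (n + 1): so the ratio of consecutive terms of Y,
-- bounded below by q n / q (n + 1), is forced past infinity after 2K + 1 steps.
concaveBound : ∀ K D → ∃ λ B → (Y : ℤ → ℕ) →
               (∀ x → suc K ℕ.* (Y x ℕ.+ Y (x ℤ.+ 1ℤ ℤ.+ 1ℤ)) ℕ.+ Y (x ℤ.+ 1ℤ) ℕ.≤ D ℕ.+ 2 ℕ.* suc K ℕ.* Y (x ℤ.+ 1ℤ)) →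
               ∀ x → Y x ℕ.≤ B
concaveBound K′ D = B , λ Y concave x → ℕ.≤-trans (ℕ.m≤n*m (Y x) (K ℕ.* (2 ℕ.* K ℕ.* 1)))
    (subst (λ z → K ℕ.* (2 ℕ.* K ℕ.* 1) ℕ.* Y x ℕ.≤ z ℕ.+ B) (vanish (suc (2 ℕ.* K)) (Y (x ℤ.+ 1ℤ)))
      (proj₂ (ratio (2 ℕ.* K) 0 (ℕ.+-identityʳ (2 ℕ.* K))) Y concave x))
  where
  K = suc K′

  Concave : (ℤ → ℕ) → Set
  Concave Y = ∀ x → K ℕ.* (Y x ℕ.+ Y (x ℤ.+ 1ℤ ℤ.+ 1ℤ)) ℕ.+ Y (x ℤ.+ 1ℤ) ℕ.≤ D ℕ.+ 2 ℕ.* K ℕ.* Y (x ℤ.+ 1ℤ)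

  vanish : ∀ n y → K ℕ.* (n ℕ.* 0) ℕ.* y ≡ 0
  vanish n y = cong (ℕ._* y) (trans (cong (K ℕ.*_) (ℕ.*-zeroʳ n)) (ℕ.*-zeroʳ K))

  regroup : ∀ K n m y₀ y₁ y₂ B → (K ℕ.* (suc n ℕ.* suc m) ℕ.* y₂ ℕ.+ B) ℕ.+ (K ℕ.* (suc n ℕ.* suc m) ℕ.* y₀ ℕ.+ suc n ℕ.* suc m ℕ.* y₁)
            ≡ suc n ℕ.* suc m ℕ.* (K ℕ.* (y₀ ℕ.+ y₂) ℕ.+ y₁) ℕ.+ B
  regroup = ℕ-Solver.solve-∀

  second-difference : ∀ K D n m y B → suc n ℕ.* suc m ℕ.* (D ℕ.+ 2 ℕ.* K ℕ.* y) ℕ.+ B ≡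
    K ℕ.* (suc (suc n) ℕ.* m) ℕ.* y ℕ.+ (suc n ℕ.* suc m ℕ.* D ℕ.+ B) ℕ.+ (K ℕ.* (n ℕ.* suc (suc m)) ℕ.* y ℕ.+ 2 ℕ.* K ℕ.* y)
  second-difference = ℕ-Solver.solve-∀

  rearrange : ∀ a b c → a ℕ.+ (b ℕ.+ c) ≡ b ℕ.+ (a ℕ.+ c)
  rearrange = ℕ-Solver.solve-∀

  -- As `n + m = 2K`, the products `n * suc m` and `suc n * m` are the weights at n and n + 1. At
  -- `m = 0` the right-hand weight is 0, and a bound on `Y x` alone remains.
  ratio : ∀ n m → n ℕ.+ m ≡ 2 ℕ.* K → ∃ λ B → ∀ Y → Concave Y → ∀ x →
          K ℕ.* (n ℕ.* suc m) ℕ.* Y x ℕ.≤ K ℕ.* (suc n ℕ.* m) ℕ.* Y (x ℤ.+ 1ℤ) ℕ.+ B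
  ratio zero    m _    = 0 , λ Y _ x → ℕ.≤-trans (ℕ.≤-reflexive (cong (ℕ._* Y x) (ℕ.*-zeroʳ K))) ℕ.z≤n
  ratio (suc n) m n+m≡2K = q ℕ.* D ℕ.+ B , λ Y concave x → step (Y x) (Y (x ℤ.+ 1ℤ)) (Y (x ℤ.+ 1ℤ ℤ.+ 1ℤ))
      (proj₂ rec Y concave (x ℤ.+ 1ℤ)) (concave x)
    where
    open ℕ.≤-Reasoning
    q = suc n ℕ.* suc m
    n+m≡2K′ = trans (ℕ.+-suc n m) n+m≡2K
    rec = ratio n (suc m) n+m≡2K′
    B = proj₁ rec

    -- The weights have second difference -2, so K times it costs 2K, to be covered by the extra
    -- term `q * y₁`. The least weight strictly between the zeros is 2K, attained at both ends:
    -- hence the length 2K + 1.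
    2K≤q : 2 ℕ.* K ℕ.≤ q
    2K≤q = begin
      2 ℕ.* K              ≡⟨ n+m≡2K′ ⟨
      n ℕ.+ suc m          ≤⟨ ℕ.+-monoˡ-≤ (suc m) (ℕ.m≤m*n n (suc m)) ⟩
      n ℕ.* suc m ℕ.+ suc m ≡⟨ ℕ.+-comm (n ℕ.* suc m) (suc m) ⟩
      q                    ∎

    step : ∀ y₀ y₁ y₂ → K ℕ.* (n ℕ.* suc (suc m)) ℕ.* y₁ ℕ.≤ K ℕ.* q ℕ.* y₂ ℕ.+ B →
           K ℕ.* (y₀ ℕ.+ y₂) ℕ.+ y₁ ℕ.≤ D ℕ.+ 2 ℕ.* K ℕ.* y₁ →
           K ℕ.* q ℕ.* y₀ ℕ.≤ K ℕ.* (suc (suc n) ℕ.* m) ℕ.* y₁ ℕ.+ (q ℕ.* D ℕ.+ B)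
    step y₀ y₁ y₂ ih h = ℕ.+-cancelʳ-≤ (K ℕ.* (n ℕ.* suc (suc m)) ℕ.* y₁ ℕ.+ q ℕ.* y₁) _ _ (begin
      K ℕ.* q ℕ.* y₀ ℕ.+ (K ℕ.* (n ℕ.* suc (suc m)) ℕ.* y₁ ℕ.+ q ℕ.* y₁)
        ≡⟨ rearrange (K ℕ.* q ℕ.* y₀) (K ℕ.* (n ℕ.* suc (suc m)) ℕ.* y₁) (q ℕ.* y₁) ⟩
      K ℕ.* (n ℕ.* suc (suc m)) ℕ.* y₁ ℕ.+ (K ℕ.* q ℕ.* y₀ ℕ.+ q ℕ.* y₁)
        ≤⟨ ℕ.+-monoˡ-≤ _ ih ⟩
      (K ℕ.* q ℕ.* y₂ ℕ.+ B) ℕ.+ (K ℕ.* q ℕ.* y₀ ℕ.+ q ℕ.* y₁)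
        ≡⟨ regroup K n m y₀ y₁ y₂ B ⟩
      q ℕ.* (K ℕ.* (y₀ ℕ.+ y₂) ℕ.+ y₁) ℕ.+ B
        ≤⟨ ℕ.+-monoˡ-≤ B (ℕ.*-monoʳ-≤ q h) ⟩
      q ℕ.* (D ℕ.+ 2 ℕ.* K ℕ.* y₁) ℕ.+ B
        ≡⟨ second-difference K D n m y₁ B ⟩
      K ℕ.* (suc (suc n) ℕ.* m) ℕ.* y₁ ℕ.+ (q ℕ.* D ℕ.+ B) ℕ.+ (K ℕ.* (n ℕ.* suc (suc m)) ℕ.* y₁ ℕ.+ 2 ℕ.* K ℕ.* y₁)
        ≤⟨ ℕ.+-monoʳ-≤ (K ℕ.* (suc (suc n) ℕ.* m) ℕ.* y₁ ℕ.+ (q ℕ.* D ℕ.+ B))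
             (ℕ.+-monoʳ-≤ (K ℕ.* (n ℕ.* suc (suc m)) ℕ.* y₁) (ℕ.*-monoˡ-≤ y₁ 2K≤q)) ⟩
      K ℕ.* (suc (suc n) ℕ.* m) ℕ.* y₁ ℕ.+ (q ℕ.* D ℕ.+ B) ℕ.+ (K ℕ.* (n ℕ.* suc (suc m)) ℕ.* y₁ ℕ.+ q ℕ.* y₁) ∎)

  B = proj₁ (ratio (2 ℕ.* K) 0 (ℕ.+-identityʳ (2 ℕ.* K)))

-- Boundedness of friezes

-- The time of the entry in row j once the rows before n have been advanced from m to m + 1.
time : ∀ {r} → ℕ → Fin r → ℤ → ℤ
time n j m with toℕ j ℕ.<? n
... | yes _ = m ℤ.+ 1ℤ
... | no  _ = m

time-< : ∀ {r n} (j : Fin r) m → toℕ j ℕ.< n → time n j m ≡ m ℤ.+ 1ℤ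
time-< {n = n} j m j<n with toℕ j ℕ.<? n
... | yes _  = refl
... | no j≮n = contradiction j<n j≮n

time-≥ : ∀ {r n} (j : Fin r) m → n ℕ.≤ toℕ j → time n j m ≡ m
time-≥ {n = n} j m n≤j with toℕ j ℕ.<? n
... | yes j<n = contradiction n≤j (ℕ.<⇒≱ j<n)
... | no _    = refl

time-suc : ∀ {r n} (j : Fin r) m → toℕ j ≢ n → time (suc n) j m ≡ time n j m
time-suc {n = n} j m j≢n with ℕ.<-cmp (toℕ j) n
... | tri< j<n _ _ = trans (time-< j m (ℕ.m<n⇒m<1+n j<n)) (sym (time-< j m j<n))
... | tri≈ _ j≡n _ = contradiction j≡n j≢n
... | tri> _ _ n<j = trans (time-≥ j m n<j) (sym (time-≥ j m (ℕ.<⇒≤ n<j)))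

weighted : ∀ {r} → Matrix r → Fin r → (Fin r → ℕ) → ℕ
weighted A i s = prodℕ (λ j → suc (s j) ℕ.^ offDiagonal A j i)

-- Defs.friezeRHS multiplies a function local to it; this makes that function available.
factorsOf : ∀ {n} {f : Fin n → ℕ} {x} → x ≡ prodℕ f → Fin n → ℕ
factorsOf {f = f} _ = f

-- `time (toℕ i)` puts the rows before `i` at m + 1 and those after it at m, which merges the two
-- partial products; row `i` itself has exponent 0.
friezeRHS≡weighted : ∀ {r} (A : Matrix r) k i m → friezeRHS A k i m ≡ weighted A i (λ j → k j (time (toℕ i) j m))
friezeRHS≡weighted A k i m = prod-cong factor≡
  where
  factor≡ : ∀ j → factorsOf (refl {x = friezeRHS A k i m}) j ≡ suc (k j (time (toℕ i) j m)) ℕ.^ offDiagonal A j i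
  factor≡ j with toℕ i ℕ.<? toℕ j | toℕ j ℕ.<? toℕ i
  ... | yes i<j | yes j<i = contradiction j<i (ℕ.<-asym i<j)
  ... | yes i<j | no  _   = cong (suc (k j m) ℕ.^_) (sym (offDiagonal-≢ A λ { refl → ℕ.<-irrefl refl i<j }))
  ... | no  _   | yes j<i = cong (suc (k j (m ℤ.+ 1ℤ)) ℕ.^_) (sym (offDiagonal-≢ A λ { refl → ℕ.<-irrefl refl j<i }))
  ... | no  i≮j | no  j≮i with Fin.toℕ-injective (ℕ.≤-antisym (ℕ.≮⇒≥ i≮j) (ℕ.≮⇒≥ j≮i))
  ...   | refl = cong (suc (k j m) ℕ.^_) (sym (offDiagonal-diag A j))

-- Integer logarithms and halving

floorLog₂ : ∀ n → 0 ℕ.< n → ∃ λ u → 2 ℕ.^ u ℕ.≤ n × n ℕ.< 2 ℕ.^ suc u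
floorLog₂ (suc zero)        _ = 0 , ℕ.≤-refl , ℕ.≤-refl
floorLog₂ (suc n@(suc _)) _ with floorLog₂ n ℕ.z<s
... | u , lower , upper with suc n ℕ.<? 2 ℕ.^ suc u
...   | yes n+1<  = u , ℕ.m≤n⇒m≤1+n lower , n+1<
...   | no  n+1≮  = suc u , ℕ.≮⇒≥ n+1≮ ,
  ℕ.≤-<-trans upper (ℕ.^-monoʳ-< 2 ℕ.≤-refl (ℕ.n<1+n (suc u)))

2^-cancel-≤ : ∀ {m n} → 2 ℕ.^ m ℕ.≤ 2 ℕ.^ n → m ℕ.≤ n
2^-cancel-≤ 2^m≤2^n = ℕ.≮⇒≥ λ n<m → ℕ.<⇒≱ (ℕ.^-monoʳ-< 2 ℕ.≤-refl n<m) 2^m≤2^n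

-- Rounds towards minus infinity on both branches; truncation towards 0 would break `half-+2` at -1.
half : ℤ → ℤ
half (+ n)      = + ℕ.⌊ n /2⌋
half ℤ.-[1+ n ] = ℤ.-[1+ ℕ.⌊ n /2⌋ ]

half-+2 : ∀ x → half (x ℤ.+ 1ℤ ℤ.+ 1ℤ) ≡ half x ℤ.+ 1ℤ
half-+2 (+ n)                   = trans
  (cong (λ m → + ℕ.⌊ m /2⌋) (trans (ℕ.+-assoc n 1 1) (ℕ.+-comm n 2))) (cong +_ (ℕ.+-comm 1 ℕ.⌊ n /2⌋))
half-+2 ℤ.-[1+ zero ]           = refl
half-+2 ℤ.-[1+ suc zero ]       = refl
half-+2 ℤ.-[1+ suc (suc n) ]    = refl

half-double : ∀ m → half (m ℤ.+ m) ≡ m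
half-double (+ n)           = cong +_ (⌊n+n/2⌋≡n n)
  where
  ⌊n+n/2⌋≡n : ∀ n → ℕ.⌊ n ℕ.+ n /2⌋ ≡ n
  ⌊n+n/2⌋≡n n = sym (ℕ.n≡⌊n+n/2⌋ n)
half-double ℤ.-[1+ n ]      = cong ℤ.-[1+_] (sym (ℕ.n≡⌈n+n/2⌉ n))

-- The index order `c j i` is that of the frieze relation; summing against `v i` then produces the
-- row sums that `Dominated` controls.
LatticeRecurrence : ∀ {n} → (Fin n → Fin n → ℕ) → (Fin n → ℤ → ℕ) → Set
LatticeRecurrence c U = ∀ i x → U i x ℕ.+ U i (x ℤ.+ 1ℤ ℤ.+ 1ℤ) ℕ.≤ ℕΣ.sum (λ j → c j i ℕ.* suc (U j (x ℤ.+ 1ℤ)))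

-- Weighting the inequalities by v turns them into one for the sequence Y x = Σ v_j (1 + U j x),
-- with a coefficient strictly below 2 because c is dominated by v.
latticeBound : ∀ {n} (c : Fin n → Fin n → ℕ) (v : Fin n → ℕ) → (∀ i → 0 ℕ.< v i) → Dominated c v →
               ∃ λ B → ∀ U → LatticeRecurrence c U → ∀ i x → U i x ℕ.≤ B
latticeBound {n} c v v>0 dom = proj₁ scalar , λ U ineq i x →
  ℕ.≤-trans (bound-entry (λ j → U j x) i) (proj₂ scalar (λ x → Y (λ j → U j x)) (λ x → concave (λ j → U j x) _ _ (λ i → ineq i x)) x)
  where
  open ℕ.≤-Reasoning
  V = ℕΣ.sum v
  -- In the integers each `dom j` has slack at least 1, worth `S` in total, and `K * S` is at least
  -- `Y u₁` because `v j < K`. This is the 1/K of the concavity estimate.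
  K = suc V
  scalar = concaveBound V (K ℕ.* (2 ℕ.* V))

  -- The `suc` matches the one in the recurrence, so the right-hand side is linear in the same
  -- quantities; the price is the constant `2 * V` in `ends`.
  Y : (Fin n → ℕ) → ℕ
  Y u = ℕΣ.sum (λ j → v j ℕ.* suc (u j))

  bound-entry : ∀ u i → u i ℕ.≤ Y u
  bound-entry u i = begin
    u i                 ≤⟨ ℕ.n≤1+n (u i) ⟩
    suc (u i)           ≤⟨ ℕ.m≤n*m (suc (u i)) (v i) {{ℕ.>-nonZero (v>0 i)}} ⟩
    v i ℕ.* suc (u i)   ≤⟨ term≤sum (λ j → v j ℕ.* suc (u j)) i ⟩
    Y u                 ∎

  split : ∀ v a b → v ℕ.* suc a ℕ.+ v ℕ.* suc b ≡ v ℕ.* (a ℕ.+ b) ℕ.+ 2 ℕ.* v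
  split = ℕ-Solver.solve-∀

  swap : ∀ v c u → v ℕ.* (c ℕ.* u) ≡ c ℕ.* v ℕ.* u
  swap = ℕ-Solver.solve-∀

  collect : ∀ K y s V → K ℕ.* (y ℕ.+ 2 ℕ.* V) ℕ.+ K ℕ.* s ≡ K ℕ.* (2 ℕ.* V) ℕ.+ K ℕ.* (y ℕ.+ s)
  collect = ℕ-Solver.solve-∀

  concave : ∀ u₀ u₁ u₂ → (∀ i → u₀ i ℕ.+ u₂ i ℕ.≤ ℕΣ.sum (λ j → c j i ℕ.* suc (u₁ j))) →
            K ℕ.* (Y u₀ ℕ.+ Y u₂) ℕ.+ Y u₁ ℕ.≤ K ℕ.* (2 ℕ.* V) ℕ.+ 2 ℕ.* K ℕ.* Y u₁
  concave u₀ u₁ u₂ ineq = begin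
    K ℕ.* (Y u₀ ℕ.+ Y u₂) ℕ.+ Y u₁                 ≤⟨ ℕ.+-mono-≤ (ℕ.*-monoʳ-≤ K ends) middle ⟩
    K ℕ.* (W ℕ.+ 2 ℕ.* V) ℕ.+ K ℕ.* S              ≡⟨ collect K W S V ⟩
    K ℕ.* (2 ℕ.* V) ℕ.+ K ℕ.* (W ℕ.+ S)            ≤⟨ ℕ.+-monoʳ-≤ (K ℕ.* (2 ℕ.* V)) (ℕ.*-monoʳ-≤ K W+S≤2Y) ⟩
    K ℕ.* (2 ℕ.* V) ℕ.+ K ℕ.* (2 ℕ.* Y u₁)         ≡⟨ cong (K ℕ.* (2 ℕ.* V) ℕ.+_) (trans (sym (ℕ.*-assoc K 2 (Y u₁))) (cong (ℕ._* Y u₁) (ℕ.*-comm K 2))) ⟩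
    K ℕ.* (2 ℕ.* V) ℕ.+ 2 ℕ.* K ℕ.* Y u₁           ∎
    where
    S = ℕΣ.sum (λ j → suc (u₁ j))
    W = ℕΣ.sum (λ j → ℕΣ.sum (λ i → c j i ℕ.* v i) ℕ.* suc (u₁ j))

    ends : Y u₀ ℕ.+ Y u₂ ℕ.≤ W ℕ.+ 2 ℕ.* V
    ends = begin
      Y u₀ ℕ.+ Y u₂
        ≡⟨ ℕΣ.∑-distrib-+ (λ i → v i ℕ.* suc (u₀ i)) (λ i → v i ℕ.* suc (u₂ i)) ⟨
      ℕΣ.sum (λ i → v i ℕ.* suc (u₀ i) ℕ.+ v i ℕ.* suc (u₂ i))
        ≡⟨ ℕΣ.sum-cong-≗ (λ i → split (v i) (u₀ i) (u₂ i)) ⟩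
      ℕΣ.sum (λ i → v i ℕ.* (u₀ i ℕ.+ u₂ i) ℕ.+ 2 ℕ.* v i)
        ≡⟨ ℕΣ.∑-distrib-+ (λ i → v i ℕ.* (u₀ i ℕ.+ u₂ i)) (λ i → 2 ℕ.* v i) ⟩
      ℕΣ.sum (λ i → v i ℕ.* (u₀ i ℕ.+ u₂ i)) ℕ.+ ℕΣ.sum (λ i → 2 ℕ.* v i)
        ≡⟨ cong (ℕΣ.sum (λ i → v i ℕ.* (u₀ i ℕ.+ u₂ i)) ℕ.+_) (ℕΣ.*-distribˡ-sum 2 v) ⟨
      ℕΣ.sum (λ i → v i ℕ.* (u₀ i ℕ.+ u₂ i)) ℕ.+ 2 ℕ.* V
        ≤⟨ ℕ.+-monoˡ-≤ (2 ℕ.* V) (sum-mono λ i → ℕ.*-monoʳ-≤ (v i) (ineq i)) ⟩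
      ℕΣ.sum (λ i → v i ℕ.* ℕΣ.sum (λ j → c j i ℕ.* suc (u₁ j))) ℕ.+ 2 ℕ.* V
        ≡⟨ cong (ℕ._+ 2 ℕ.* V) (ℕΣ.sum-cong-≗ λ i → trans
             (ℕΣ.*-distribˡ-sum (v i) (λ j → c j i ℕ.* suc (u₁ j))) (ℕΣ.sum-cong-≗ λ j → swap (v i) (c j i) (suc (u₁ j)))) ⟩
      ℕΣ.sum (λ i → ℕΣ.sum (λ j → c j i ℕ.* v i ℕ.* suc (u₁ j))) ℕ.+ 2 ℕ.* V
        ≡⟨ cong (ℕ._+ 2 ℕ.* V) (ℕΣ.∑-comm (λ i j → c j i ℕ.* v i ℕ.* suc (u₁ j))) ⟩
      ℕΣ.sum (λ j → ℕΣ.sum (λ i → c j i ℕ.* v i ℕ.* suc (u₁ j))) ℕ.+ 2 ℕ.* V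
        ≡⟨ cong (ℕ._+ 2 ℕ.* V) (ℕΣ.sum-cong-≗ λ j → ℕΣ.*-distribʳ-sum (suc (u₁ j)) (λ i → c j i ℕ.* v i)) ⟨
      W ℕ.+ 2 ℕ.* V ∎

    middle : Y u₁ ℕ.≤ K ℕ.* S
    middle = begin
      Y u₁                                ≤⟨ sum-mono (λ j → ℕ.*-monoˡ-≤ (suc (u₁ j)) (ℕ.m≤n⇒m≤1+n (term≤sum v j))) ⟩
      ℕΣ.sum (λ j → K ℕ.* suc (u₁ j))     ≡⟨ ℕΣ.*-distribˡ-sum K (λ j → suc (u₁ j)) ⟨
      K ℕ.* S                             ∎

    W+S≤2Y : W ℕ.+ S ℕ.≤ 2 ℕ.* Y u₁
    W+S≤2Y = begin
      W ℕ.+ S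
        ≡⟨ ℕΣ.∑-distrib-+ (λ j → ℕΣ.sum (λ i → c j i ℕ.* v i) ℕ.* suc (u₁ j)) (λ j → suc (u₁ j)) ⟨
      ℕΣ.sum (λ j → ℕΣ.sum (λ i → c j i ℕ.* v i) ℕ.* suc (u₁ j) ℕ.+ suc (u₁ j))
        ≤⟨ sum-mono (λ j → subst₂ ℕ._≤_ (ℕ.+-comm (suc (u₁ j)) _) (ℕ.*-assoc 2 (v j) (suc (u₁ j)))
             (ℕ.*-monoˡ-≤ (suc (u₁ j)) (dom j))) ⟩
      ℕΣ.sum (λ j → 2 ℕ.* (v j ℕ.* suc (u₁ j)))
        ≡⟨ ℕΣ.*-distribˡ-sum 2 (λ j → v j ℕ.* suc (u₁ j)) ⟨
      2 ℕ.* Y u₁ ∎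

-- Placing the rows of a frieze on a common line

earlier : ∀ {n} → Fin n → Fin n → ℕ
earlier i j with toℕ i ℕ.<? toℕ j
... | yes _ = 1
... | no  _ = 0

earlier-< : ∀ {n} {i j : Fin n} → toℕ i ℕ.< toℕ j → earlier i j ≡ 1
earlier-< {i = i} {j} i<j with toℕ i ℕ.<? toℕ j
... | yes _  = refl
... | no i≮j = contradiction i<j i≮j

earlier-≥ : ∀ {n} {i j : Fin n} → toℕ j ℕ.≤ toℕ i → earlier i j ≡ 0
earlier-≥ {i = i} {j} j≤i with toℕ i ℕ.<? toℕ j
... | yes i<j = contradiction j≤i (ℕ.<⇒≱ i<j)
... | no _    = refl

increment : ∀ {n} → Fin n → Fin n → ℤ
increment i j = earlier i j ℤ.⊖ earlier j i

increment-< : ∀ {n} {i j : Fin n} → toℕ i ℕ.< toℕ j → increment i j ≡ 1ℤ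
increment-< i<j = cong₂ ℤ._⊖_ (earlier-< i<j) (earlier-≥ (ℕ.<⇒≤ i<j))

offDiagonal-sym : ∀ {n} (A : Matrix n) → IsCartan A → ∀ i j → offDiagonal A i j ≡ 0 → offDiagonal A j i ≡ 0
offDiagonal-sym A cartan i j cij≡0 with i ≟ j
... | yes refl = offDiagonal-diag A i
... | no i≢j   = trans (offDiagonal-≢ A (i≢j ∘ sym))
  (cong ∣_∣ (IsCartan.zeroSym cartan i j (ℤ.∣i∣≡0⇒i≡0 cij≡0)))

cartanPotential : ∀ {r} (A : Matrix r) → IsCartan A → (v : Fin r → ℕ) → Dominated (offDiagonal A) v →
                  ∃ λ (s : Fin r → ℤ) → ∀ i j → offDiagonal A i j ≢ 0 → s i ≡ s j ℤ.+ increment i j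
cartanPotential A cartan v =
  potential (offDiagonal A) increment v (offDiagonal-diag A) (offDiagonal-sym A cartan)
    (λ i j → ℤ.⊖-swap (earlier j i) (earlier i j))

-- With (i , m) placed at the points x such that half (x + s i) = m, all the neighbours that enter
-- the recurrence for row i between the points x and x + 2 lie at x + 1, whatever the order of the rows.
half-time : ∀ {r} (s : Fin r → ℤ) i j → i ≢ j → s i ≡ s j ℤ.+ increment i j → s j ≡ s i ℤ.+ increment j i →
            ∀ x → time (toℕ i) j (half (x ℤ.+ s i)) ≡ half (x ℤ.+ 1ℤ ℤ.+ s j)
half-time s i j i≢j sᵢ sⱼ x with ℕ.<-cmp (toℕ i) (toℕ j)
... | tri≈ _ i≡j _ = contradiction (Fin.toℕ-injective i≡j) i≢j
... | tri< i<j _ _ = trans (time-≥ j (half (x ℤ.+ s i)) (ℕ.<⇒≤ i<j)) (cong half (begin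
  x ℤ.+ s i                       ≡⟨ cong (ℤ._+_ x) (trans sᵢ (cong (ℤ._+_ (s j)) (increment-< i<j))) ⟩
  x ℤ.+ (s j ℤ.+ 1ℤ)              ≡⟨ shift x (s j) ⟩
  x ℤ.+ 1ℤ ℤ.+ s j                ∎))
  where
  open ≡-Reasoning
  shift : ∀ x s → x ℤ.+ (s ℤ.+ 1ℤ) ≡ x ℤ.+ 1ℤ ℤ.+ s
  shift = ℤ-Solver.solve-∀
... | tri> _ _ j<i = begin
  time (toℕ i) j (half (x ℤ.+ s i))   ≡⟨ time-< j (half (x ℤ.+ s i)) j<i ⟩
  half (x ℤ.+ s i) ℤ.+ 1ℤ             ≡⟨ half-+2 (x ℤ.+ s i) ⟨
  half (x ℤ.+ s i ℤ.+ 1ℤ ℤ.+ 1ℤ)      ≡⟨ cong half (shift x (s i)) ⟩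
  half (x ℤ.+ 1ℤ ℤ.+ (s i ℤ.+ 1ℤ))    ≡⟨ cong (λ y → half (x ℤ.+ 1ℤ ℤ.+ y)) (trans sⱼ (cong (ℤ._+_ (s i)) (increment-< j<i))) ⟨
  half (x ℤ.+ 1ℤ ℤ.+ s j)             ∎
  where
  open ≡-Reasoning
  shift : ∀ x s → x ℤ.+ s ℤ.+ 1ℤ ℤ.+ 1ℤ ≡ x ℤ.+ 1ℤ ℤ.+ (s ℤ.+ 1ℤ)
  shift = ℤ-Solver.solve-∀

-- Rounding logarithms down costs nothing: both log k ≥ u and log (1 + k) ≤ u + 1 go the right way.
logRecurrence : ∀ {r} (A : Matrix r) k → IsArithYFrieze A k →
                ∃ λ (u : Fin r → ℤ → ℕ) → (∀ i m → k i m ℕ.≤ 2 ℕ.^ suc (u i m)) ×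
                  (∀ i m → u i m ℕ.+ u i (m ℤ.+ 1ℤ) ℕ.≤ ℕΣ.sum (λ j → offDiagonal A j i ℕ.* suc (u j (time (toℕ i) j m))))
logRecurrence {r} A k (k>0 , relation) = u , (λ i m → ℕ.<⇒≤ (upper i m)) , λ i m → 2^-cancel-≤ (begin
  2 ℕ.^ (u i m ℕ.+ u i (m ℤ.+ 1ℤ))
    ≡⟨ ℕ.^-distribˡ-+-* 2 (u i m) (u i (m ℤ.+ 1ℤ)) ⟩
  2 ℕ.^ u i m ℕ.* 2 ℕ.^ u i (m ℤ.+ 1ℤ)
    ≤⟨ ℕ.*-mono-≤ (lower i m) (lower i (m ℤ.+ 1ℤ)) ⟩
  k i m ℕ.* k i (m ℤ.+ 1ℤ)
    ≡⟨ trans (relation i m) (friezeRHS≡weighted A k i m) ⟩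
  weighted A i (λ j → k j (time (toℕ i) j m))
    ≤⟨ prod-mono (λ j → power≤ (offDiagonal A j i) j (time (toℕ i) j m)) ⟩
  prodℕ (λ j → 2 ℕ.^ (offDiagonal A j i ℕ.* suc (u j (time (toℕ i) j m))))
    ≡⟨ prod-^ 2 (λ j → offDiagonal A j i ℕ.* suc (u j (time (toℕ i) j m))) ⟩
  2 ℕ.^ ℕΣ.sum (λ j → offDiagonal A j i ℕ.* suc (u j (time (toℕ i) j m))) ∎)
  where
  open ℕ.≤-Reasoning

  log : ∀ i m → ∃ λ u → 2 ℕ.^ u ℕ.≤ k i m × k i m ℕ.< 2 ℕ.^ suc u
  log i m = floorLog₂ (k i m) (k>0 i m)

  u : Fin r → ℤ → ℕ
  u i m = proj₁ (log i m)

  lower : ∀ i m → 2 ℕ.^ u i m ℕ.≤ k i m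
  lower i m = proj₁ (proj₂ (log i m))

  upper : ∀ i m → k i m ℕ.< 2 ℕ.^ suc (u i m)
  upper i m = proj₂ (proj₂ (log i m))

  power≤ : ∀ c j t → suc (k j t) ℕ.^ c ℕ.≤ 2 ℕ.^ (c ℕ.* suc (u j t))
  power≤ c j t = begin
    suc (k j t) ℕ.^ c              ≤⟨ ℕ.^-monoˡ-≤ c (upper j t) ⟩
    (2 ℕ.^ suc (u j t)) ℕ.^ c      ≡⟨ ℕ.^-*-assoc 2 (suc (u j t)) c ⟩
    2 ℕ.^ (suc (u j t) ℕ.* c)      ≡⟨ cong (2 ℕ.^_) (ℕ.*-comm (suc (u j t)) c) ⟩
    2 ℕ.^ (c ℕ.* suc (u j t))      ∎

module _ {r} (A : Matrix r) (cartan : IsCartan A)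
  (s : Fin r → ℤ) (s-edge : ∀ i j → offDiagonal A i j ≢ 0 → s i ≡ s j ℤ.+ increment i j)
  (B : ℕ) (lattice : ∀ U → LatticeRecurrence (offDiagonal A) U → ∀ i x → U i x ℕ.≤ B) where
  private
    c = offDiagonal A
  open ℕ.≤-Reasoning

  edge-time : ∀ i j x → c j i ≢ 0 → time (toℕ i) j (half (x ℤ.+ s i)) ≡ half (x ℤ.+ 1ℤ ℤ.+ s j)
  edge-time i j x cji≢0 = half-time s i j (λ { refl → cji≢0 (offDiagonal-diag A i) })
    (s-edge i j (cji≢0 ∘ offDiagonal-sym A cartan i j)) (s-edge j i cji≢0) x

  module _ (u : Fin r → ℤ → ℕ)
    (recurrence : ∀ i m → u i m ℕ.+ u i (m ℤ.+ 1ℤ) ℕ.≤ ℕΣ.sum (λ j → c j i ℕ.* suc (u j (time (toℕ i) j m)))) where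

    -- Each entry of a row occupies two consecutive points, so the recurrence holds at every `x`
    -- without a parity condition.
    U : Fin r → ℤ → ℕ
    U i x = u i (half (x ℤ.+ s i))

    shift : ∀ x s → x ℤ.+ 1ℤ ℤ.+ 1ℤ ℤ.+ s ≡ x ℤ.+ s ℤ.+ 1ℤ ℤ.+ 1ℤ
    shift = ℤ-Solver.solve-∀

    retime : ∀ i j x → c j i ℕ.* suc (u j (time (toℕ i) j (half (x ℤ.+ s i)))) ≡ c j i ℕ.* suc (U j (x ℤ.+ 1ℤ))
    -- The potential aligns only rows joined by an edge; for the others the coefficient 0 makes the
    -- time irrelevant.
    retime i j x with c j i ℕ.≟ 0
    ... | yes cji≡0 = trans (cong (ℕ._* suc (u j (time (toℕ i) j (half (x ℤ.+ s i))))) cji≡0)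
                            (sym (cong (ℕ._* suc (U j (x ℤ.+ 1ℤ))) cji≡0))
    ... | no  cji≢0 = cong (λ t → c j i ℕ.* suc (u j t)) (edge-time i j x cji≢0)

    lattice-recurrence : LatticeRecurrence c U
    lattice-recurrence i x = begin
      U i x ℕ.+ U i (x ℤ.+ 1ℤ ℤ.+ 1ℤ)
        ≡⟨ cong (λ t → U i x ℕ.+ u i t) (trans (cong half (shift x (s i))) (half-+2 (x ℤ.+ s i))) ⟩
      u i (half (x ℤ.+ s i)) ℕ.+ u i (half (x ℤ.+ s i) ℤ.+ 1ℤ)
        ≤⟨ recurrence i (half (x ℤ.+ s i)) ⟩
      ℕΣ.sum (λ j → c j i ℕ.* suc (u j (time (toℕ i) j (half (x ℤ.+ s i)))))
        ≡⟨ ℕΣ.sum-cong-≗ (λ j → retime i j x) ⟩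
      ℕΣ.sum (λ j → c j i ℕ.* suc (U j (x ℤ.+ 1ℤ))) ∎

    cancel : ∀ m s → m ℤ.+ m ℤ.- s ℤ.+ s ≡ m ℤ.+ m
    cancel = ℤ-Solver.solve-∀

    u≤B : ∀ i m → u i m ℕ.≤ B
    -- Row `i` shows its entry at time `m` at the point 2m - s i, so every entry is reached.
    u≤B i m = subst (λ t → u i t ℕ.≤ B) (trans (cong half (cancel m (s i))) (half-double m))
      (lattice U lattice-recurrence i (m ℤ.+ m ℤ.- s i))

  lattice⇒friezeBound : ∀ k → IsArithYFrieze A k → ∀ i m → k i m ℕ.≤ 2 ℕ.^ suc B
  lattice⇒friezeBound k frieze i m =
    let u , k≤ , recurrence = logRecurrence A k frieze
    in ℕ.≤-trans (k≤ i m) (ℕ.^-monoʳ-≤ 2 (ℕ.s≤s (u≤B u recurrence i m)))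

friezeBound : ∀ {r} (A : Matrix r) → IsCartan A → FiniteType A →
              ∃ λ B → ∀ k → IsArithYFrieze A k → ∀ i m → k i m ℕ.≤ B
friezeBound A cartan ft =
  let v , v>0 , Av>0 = finiteType⇒positive A (IsCartan.offdiag cartan) ft
      dom            = offDiagonal-dominated A cartan v Av>0
      s , s-edge     = cartanPotential A cartan v dom
      B , lattice    = latticeBound (offDiagonal A) v v>0 dom
  in 2 ℕ.^ suc B , lattice⇒friezeBound A cartan s s-edge B lattice

-- Reconstruction of a frieze from one time slice

-- Row `i` has exponent 0 in its own weight, which therefore reads the same before and after that
-- row is mutated; so the same operation serves in both directions.
weighted-cong : ∀ {r} (A : Matrix r) i {s t : Fin r → ℕ} → (∀ j → j ≢ i → s j ≡ t j) → weighted A i s ≡ weighted A i t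
weighted-cong A i {s} {t} s≗t = prod-cong factor≡
  where
  factor≡ : ∀ j → suc (s j) ℕ.^ offDiagonal A j i ≡ suc (t j) ℕ.^ offDiagonal A j i
  factor≡ j with j ≟ i
  ... | yes _  = refl
  ... | no j≢i = cong (λ x → suc x ℕ.^ ∣ A j i ∣) (s≗t j j≢i)

-- The value at divisor 0 is a filler: `mutate` must act on all vectors, while the entries of a
-- frieze are positive.
quotient : ℕ → ℕ → ℕ
quotient m zero    = 0
quotient m (suc n) = m ℕ./ suc n

quotient-* : ∀ {m} n → 0 ℕ.< m → quotient (m ℕ.* n) m ≡ n
quotient-* {suc m} n _ = trans (cong (ℕ._/ suc m) (ℕ.*-comm (suc m) n)) (ℕ.m*n/n≡m n (suc m))

module _ {r} (A : Matrix r) where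

  -- Advances row n by one time step, if the rows before n have already been advanced;
  -- the same operation takes it back, by the symmetry of the frieze relation.
  mutate : ℕ → (Fin r → ℕ) → Fin r → ℕ
  mutate n s j with toℕ j ℕ.≟ n
  ... | yes _ = quotient (weighted A j s) (s j)
  ... | no  _ = s j

  advance : ℕ → (Fin r → ℕ) → Fin r → ℕ
  advance zero    s = s
  advance (suc n) s = mutate n (advance n s)

  retreat : ℕ → (Fin r → ℕ) → Fin r → ℕ
  retreat zero    s = s
  retreat (suc n) s = retreat n (mutate n s)

  orbit : (Fin r → ℕ) → ℤ → Fin r → ℕ
  orbit s (+ zero)             = s
  orbit s (+ suc n)            = advance r (orbit s (+ n))
  orbit s ℤ.-[1+ zero ]        = retreat r s
  orbit s ℤ.-[1+ suc n ]       = retreat r (orbit s ℤ.-[1+ n ])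

  module _ (k : Fin r → ℤ → ℕ) (frieze : IsArithYFrieze A k) where
    private
      k>0 = proj₁ frieze

    stage : ℕ → ℤ → Fin r → ℕ
    stage n m j = k j (time n j m)

    relation : ∀ j m → weighted A j (stage (toℕ j) m) ≡ k j m ℕ.* k j (m ℤ.+ 1ℤ)
    relation j m = sym (trans (proj₂ frieze j m) (friezeRHS≡weighted A k j m))

    mutate-forward : ∀ n m {s} → (∀ j → s j ≡ stage n m j) → ∀ j → mutate n s j ≡ stage (suc n) m j
    mutate-forward n m {s} s≗ j with toℕ j ℕ.≟ n
    ... | no j≢n   = trans (s≗ j) (cong (k j) (sym (time-suc j m j≢n)))
    ... | yes refl = begin
      quotient (weighted A j s) (s j)                       ≡⟨ cong₂ quotient (weighted-cong A j λ l _ → s≗ l) (trans (s≗ j) (cong (k j) (time-≥ j m ℕ.≤-refl))) ⟩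
      quotient (weighted A j (stage n m)) (k j m)           ≡⟨ cong (λ x → quotient x (k j m)) (relation j m) ⟩
      quotient (k j m ℕ.* k j (m ℤ.+ 1ℤ)) (k j m)           ≡⟨ quotient-* (k j (m ℤ.+ 1ℤ)) (k>0 j m) ⟩
      k j (m ℤ.+ 1ℤ)                                        ≡⟨ cong (k j) (time-< j m ℕ.≤-refl) ⟨
      stage (suc n) m j                                     ∎
      where open ≡-Reasoning

    mutate-backward : ∀ n m {s} → (∀ j → s j ≡ stage (suc n) m j) → ∀ j → mutate n s j ≡ stage n m j
    mutate-backward n m {s} s≗ j with toℕ j ℕ.≟ n
    ... | no j≢n   = trans (s≗ j) (cong (k j) (time-suc j m j≢n))
    ... | yes refl = begin
      quotient (weighted A j s) (s j)                       ≡⟨ cong₂ quotient (weighted-cong A j λ l l≢j → trans (s≗ l) (cong (k l) (time-suc l m (l≢j ∘ Fin.toℕ-injective))))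
                                                                 (trans (s≗ j) (cong (k j) (time-< j m ℕ.≤-refl))) ⟩
      quotient (weighted A j (stage n m)) (k j (m ℤ.+ 1ℤ))  ≡⟨ cong (λ x → quotient x (k j (m ℤ.+ 1ℤ))) (trans (relation j m) (ℕ.*-comm (k j m) _)) ⟩
      quotient (k j (m ℤ.+ 1ℤ) ℕ.* k j m) (k j (m ℤ.+ 1ℤ))  ≡⟨ quotient-* (k j m) (k>0 j (m ℤ.+ 1ℤ)) ⟩
      k j m                                                 ≡⟨ cong (k j) (time-≥ j m ℕ.≤-refl) ⟨
      stage n m j                                           ∎
      where open ≡-Reasoning

    advance-stage : ∀ n m {s} → (∀ j → s j ≡ k j m) → ∀ j → advance n s j ≡ stage n m j
    advance-stage zero    m s≗ j = trans (s≗ j) (cong (k j) (sym (time-≥ j m ℕ.z≤n)))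
    advance-stage (suc n) m s≗   = mutate-forward n m (advance-stage n m s≗)

    retreat-stage : ∀ n m {s} → (∀ j → s j ≡ stage n m j) → ∀ j → retreat n s j ≡ k j m
    retreat-stage zero    m s≗ j = trans (s≗ j) (cong (k j) (time-≥ j m ℕ.z≤n))
    retreat-stage (suc n) m s≗   = retreat-stage n m (mutate-backward n m s≗)

    advance-frieze : ∀ m {s} → (∀ j → s j ≡ k j m) → ∀ j → advance r s j ≡ k j (m ℤ.+ 1ℤ)
    advance-frieze m s≗ j = trans (advance-stage r m s≗ j) (cong (k j) (time-< j m (Fin.toℕ<n j)))

    retreat-frieze : ∀ m {s} → (∀ j → s j ≡ k j (m ℤ.+ 1ℤ)) → ∀ j → retreat r s j ≡ k j m
    retreat-frieze m s≗ = retreat-stage r m λ j → trans (s≗ j) (cong (k j) (sym (time-< j m (Fin.toℕ<n j))))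

    orbit-frieze : ∀ {s} → (∀ j → s j ≡ k j 0ℤ) → ∀ m j → orbit s m j ≡ k j m
    orbit-frieze s≗ (+ zero)         j = s≗ j
    orbit-frieze s≗ (+ suc n)        j = trans (advance-frieze (+ n) (orbit-frieze s≗ (+ n)) j)
                                               (cong (λ n → k j (+ n)) (ℕ.+-comm n 1))
    orbit-frieze s≗ ℤ.-[1+ zero ]    j = retreat-frieze ℤ.-[1+ zero ] s≗ j
    orbit-frieze s≗ ℤ.-[1+ suc n ]   j = retreat-frieze ℤ.-[1+ suc n ] (orbit-frieze s≗ ℤ.-[1+ n ]) j

boundedVectors : ℕ → ∀ n → List (Fin n → ℕ)
boundedVectors B zero    = (λ ()) ∷ []
boundedVectors B (suc n) = cartesianProductWith Vector._∷_ (upTo (suc B)) (boundedVectors B n)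

∈-boundedVectors : ∀ B {n} (s : Fin n → ℕ) → (∀ i → s i ℕ.≤ B) → ∃ λ t → t ∈ boundedVectors B n × (∀ i → t i ≡ s i)
∈-boundedVectors B {zero}  s s≤B = _ , here refl , λ ()
∈-boundedVectors B {suc n} s s≤B =
  let t , t∈ , t≗ = ∈-boundedVectors B (s ∘ suc) (s≤B ∘ suc)
  in s zero Vector.∷ t , ∈-cartesianProductWith⁺ Vector._∷_ (∈-upTo⁺ (ℕ.s≤s (s≤B zero))) t∈ ,
     λ { zero → refl ; (suc i) → t≗ i }

-- The list holds the orbit of every vector in the box, including those that belong to no frieze;
-- `FiniteSet` asks only that each frieze be listed up to pointwise equality.
bounded⇒finite : ∀ {r} (A : Matrix r) B → (∀ k → IsArithYFrieze A k → ∀ i m → k i m ℕ.≤ B) →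
                 FiniteSet (IsArithYFrieze A)
bounded⇒finite {r} A B bound = map (λ s i m → orbit A s m i) (boundedVectors B r) , λ k frieze →
  let s , s∈ , s≗ = ∈-boundedVectors B (λ i → k i 0ℤ) (λ i → bound k frieze i 0ℤ)
  in (λ i m → orbit A s m i) , ∈-map⁺ (λ s i m → orbit A s m i) s∈ ,
     λ i m → sym (orbit-frieze A k frieze s≗ m i)

theorem5p5 : (r : ℕ) (A : Matrix r) → IsCartan A → FiniteType A → Indecomposable A →
    FiniteSet (IsArithYFrieze A)
theorem5p5 r A cartan ft _ = let B , bound = friezeBound A cartan ft in bounded⇒finite A B bound
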